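{- Let $S$ be a commutative semiring. The class of $S$-weighted tree languages recognized by WFTA over $S$ is closed under inverses of homomorphisms if and only if $S$ is locally finite.
   Context: A semiring $(S,+,\cdot,0,1)$ has $(S,+,0)$ a commutative monoid, $(S,\cdot,1)$ a monoid, $0$ absorbing, and both distributive laws; it is commutative if $\cdot$ is commutative. $S$ is locally finite if for every finite $X\subseteq S$ the subsemiring generated by $X$ is finite. A ranked alphabet is a finite non-empty set $\Gamma$ with a map $\mathrm{Rank}:\Gamma\to\mathbb N$; $\Gamma^{(k)}$ is the set of symbols of rank $k$, $\mathrm{Rank}(\Gamma)$ the maximal rank. $T_\Gamma[X_n]$ is the set of $\Gamma$-terms/trees over variables $x_1,\dots,x_n$, $T_\Gamma$ the set of those without variables; $t\langle t_1,\dots,t_n\rangle$ is simultaneous substitution of $t_i$ for all occurrences of $x_i$. An $S$-weighted tree language is a map $T_\Gamma\to S$ for some ranked alphabet $\Gamma$. A tree homomorphism $h:T_\Lambda\to T_\Gamma$ is a map such that for each $g\in\Lambda^{(k)}$ there is a tree $h(g)\in T_\Gamma[X_k]$ with $h(g(t_1,\dots,t_k))=h(g)\langle h(t_1),\dots,h(t_k)\rangle$ for all $t_1,\dots,t_k\in T_\Lambda$ (variables may be repeated or omitted in $h(g)$). A weighted finite tree automaton (WFTA) over $S$ is $\mathcal A=(Q,\Gamma,\delta,\lambda)$ with $Q$ a finite set of states, $\Gamma$ a ranked alphabet, $\delta=(\delta_k)_{0\le k\le\mathrm{Rank}(\Gamma)}$, $\delta_k:\Gamma^{(k)}\to S^{Q^k\times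 Q}$ (write $\delta_g=\delta_k(g)$), and $\lambda:Q\to S$. State behavior: $[\mathcal A]_q(g(t_1,\dots,t_k))=\sum_{(p_1,\dots,p_k)\in Q^k}\delta_g((p_1,\dots,p_k),q)\prod_{i=1}^k[\mathcal A]_{p_i}(t_i)$. Behavior: $[\![\mathcal A]\!](t)=\sum_{q\in Q}\lambda(q)[\mathcal A]_q(t)$. $\mathcal A$ recognizes $u:T_\Gamma\to S$ if $[\![\mathcal A]\!]=u$. The class of $S$-weighted tree languages recognized by WFTA is closed under inverses of homomorphisms if for all ranked alphabets $\Lambda,\Gamma$, every tree homomorphism $h:T_\Lambda\to T_\Gamma$ and every $u:T_\Gamma\to S$ recognized by a WFTA, the weighted tree language $h^{ -1}(u)=u\circ h:T_\Lambda\to S$ is recognized by a WFTA. -}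

module Defs where

open import Algebra.Bundles using (Semiring)
import Algebra.Properties.Semiring.Sum as SemiringSum
open import Data.Fin.Base using (Fin)
open import Data.List.Base using (List)
import Data.List.Membership.Setoid as SetoidMembership
open import Data.List.Relation.Unary.Enumerates.Setoid using (IsEnumeration)
open import Data.Nat.Base using (ℕ; zero; suc; NonZero)
open import Data.Product.Base using (Σ; ∃; proj₁)
open import Data.Vec.Base using (Vec; []; _∷_; lookup; map)
open import Function.Base using (_∘_)
open import Level using (Level; _⊔_)
open import Relation.Binary.Bundles using (Setoid)
import Relation.Binary.Construct.On as On
open import Relation.Binary.PropositionalEquality.Core using (_≡_)

private
  variable
    c ℓ : Level
    m n : ℕ

-- Finite sets (of symbols, and of states below) are represented by Fin.
record RankedAlphabet : Set where
  field
    size     : ℕ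
    nonEmpty : NonZero size
    rank     : Fin size → ℕ

  Symbol : Set
  Symbol = Fin size

open RankedAlphabet public

-- Term Γ n is T_Γ[X_n]; the variable x_{i+1} is var i with i : Fin n.
data Term (Γ : RankedAlphabet) (n : ℕ) : Set where
  var  : Fin n → Term Γ n
  node : (g : Symbol Γ) → Vec (Term Γ n) (rank Γ g) → Term Γ n

Tree : RankedAlphabet → Set
Tree Γ = Term Γ 0

module _ {Γ : RankedAlphabet} where

  infixl 8 _⟨_⟩ _⟨_⟩*

  mutual
    _⟨_⟩ : Term Γ n → Vec (Term Γ m) n → Term Γ m
    var i     ⟨ us ⟩ = lookup us i
    node g ts ⟨ us ⟩ = node g (ts ⟨ us ⟩*)

    -- map (_⟨ us ⟩), spelled out for the termination checker
    _⟨_⟩* : ∀ {k} → Vec (Term Γ n) k → Vec (Term Γ m) n → Vec (Term Γ m) k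
    []       ⟨ us ⟩* = []
    (t ∷ ts) ⟨ us ⟩* = t ⟨ us ⟩ ∷ ts ⟨ us ⟩*

IsTreeHomomorphism : (Λ Γ : RankedAlphabet) → (Tree Λ → Tree Γ) → Set
IsTreeHomomorphism Λ Γ h =
  ∀ (g : Symbol Λ) → ∃ λ (s : Term Γ (rank Λ g)) →
    ∀ (ts : Vec (Tree Λ) (rank Λ g)) → h (node g ts) ≡ s ⟨ map h ts ⟩

module _ (S : Semiring c ℓ) where

  open Semiring S using (Carrier; _≈_; _+_; _*_; 0#; 1#; setoid)
  open SemiringSum S using (sum)
  open SetoidMembership setoid using (_∈_)

  data Generated (X : List Carrier) : Carrier → Set (c ⊔ ℓ) where
    gen  : ∀ {x} → x ∈ X → Generated X x
    zero : Generated X 0#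
    one  : Generated X 1#
    add  : ∀ {x y} → Generated X x → Generated X y → Generated X (x + y)
    mul  : ∀ {x y} → Generated X x → Generated X y → Generated X (x * y)
    resp : ∀ {x y} → x ≈ y → Generated X x → Generated X y

  generatedSetoid : List Carrier → Setoid (c ⊔ ℓ) ℓ
  generatedSetoid X = On.setoid setoid (proj₁ {B = Generated X})

  -- Finiteness is up to _≈_, so the enumeration may contain repetitions.
  LocallyFinite : Set (c ⊔ ℓ)
  LocallyFinite = ∀ (X : List Carrier) →
    ∃ λ (ys : List (Σ Carrier (Generated X))) → IsEnumeration (generatedSetoid X) ys

  record WFTA (Γ : RankedAlphabet) : Set c where
    field
      states : ℕ
      δ      : (g : Symbol Γ) → Vec (Fin states) (rank Γ g) → Fin states → Carrier
      final  : Fin states → Carrier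

  -- sumVec k f is the sum of f over all of (Fin n)^k.
  sumVec : ∀ k → (Vec (Fin n) k → Carrier) → Carrier
  sumVec zero    f = f []
  sumVec (suc k) f = sum (λ p → sumVec k (λ ps → f (p ∷ ps)))

  module _ {Γ : RankedAlphabet} (A : WFTA Γ) where

    open WFTA A

    mutual
      stateBehavior : Tree Γ → Fin states → Carrier
      stateBehavior (node g ts) q =
        sumVec (rank Γ g) (λ ps → δ g ps q * productBehavior ts ps)

      -- the product over i of stateBehavior t_i p_i
      productBehavior : ∀ {k} → Vec (Tree Γ) k → Vec (Fin states) k → Carrier
      productBehavior []       []       = 1#
      productBehavior (t ∷ ts) (p ∷ ps) = stateBehavior t p * productBehavior ts ps

    behavior : Tree Γ → Carrier
    behavior t = sum (λ q → final q * stateBehavior t q)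

  Recognizable : {Γ : RankedAlphabet} → (Tree Γ → Carrier) → Set (c ⊔ ℓ)
  Recognizable {Γ} u = ∃ λ (A : WFTA Γ) → ∀ t → behavior A t ≈ u t

  ClosedUnderInverseHomomorphisms : Set (c ⊔ ℓ)
  ClosedUnderInverseHomomorphisms =
    ∀ (Λ Γ : RankedAlphabet) (h : Tree Λ → Tree Γ) → IsTreeHomomorphism Λ Γ h →
    ∀ (u : Tree Γ → Carrier) → Recognizable u → Recognizable (u ∘ h)

module Submission where

-- If S is locally finite, an automaton A only takes values in the finite subsemiring generated by
-- its weights, so the vector of its state behaviors at h(t) can be tracked by a deterministic
-- bottom-up automaton on t. No decidable equality is needed: a state stores, for every state of A,
-- an index into an enumeration of that subsemiring.
--
-- Conversely, apply closure to the homomorphism that replaces f(t) by g(t,t,t,t) and to the tree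
-- language x ^ (number of leaves). This factors the Hankel matrix x ^ 4^(i+j) through some S^n.
-- * Its minors of order n + 1 vanish as formal differences, and their leading terms do not cancel:
--   x ^ d + p(x) ≈ q(x) with p, q sums of powers below d that depend on n only. At powers of 2 this
--   bounds the additive order of 1, so some positive multiple ι of 1 satisfies ι + ι ≈ ι.
-- * Expanding products of n + 1 entries over the n "colours" of S^n, every term repeats a colour, so
--   two of its rows can exchange columns, which changes the exponent. Comparing the terms of large
--   powers (a mixed term occurs often enough to be absorbed) gives x ^ (b + p) ≲ x ^ b ≲ x ^ (b + p)
--   for u ≲ v :⇔ v ≈ u + (something).
-- * Then x ^ b and x ^ (b + p) differ by a d acting on x ^ b like an element of a finite group, and
--   the monic equation of x ^ p leaves finitely many values for x ^ (b + i p).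
-- So every element has finite multiplicative and additive order, and finitely many elements generate
-- finitely many monomials and finitely many sums of monomials.

open import Defs
open import Algebra.Bundles using (CommutativeMonoid; CommutativeSemigroup; CommutativeSemiring; Semiring)
import Algebra.Construct.DirectProduct as DirectProduct
import Algebra.Properties.CommutativeMonoid.Sum as CommutativeMonoidSum
open import Data.Fin.Base as Fin using (Fin; zero; suc; finToFun; funToFin; punchOut; toℕ)
open import Data.Fin.Properties
  using (<⇒≢; finToFun-funToFin; pigeonhole; punchIn-punchOut; toℕ≤pred[n])
open import Data.List.Base as List
  using (List; []; _∷_; _++_; allFin; cartesianProductWith; concatMap; downFrom; length; map; upTo)
open import Data.List.Membership.Propositional.Properties
  using (∈-allFin; ∈-cartesianProductWith⁺; ∈-concatMap⁺; ∈-map⁺; ∈-upTo⁺)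
open import Data.List.Properties using (++-assoc; length-++; length-downFrom; map-++)
open import Data.List.Relation.Unary.All as All using (All; []; _∷_)
import Data.List.Relation.Unary.All.Properties as All
open import Data.List.Relation.Unary.Any as Any using (Any; here; there; index)
import Data.List.Relation.Unary.Any.Properties as Any
open import Data.Nat.Base as ℕ using (ℕ; zero; suc; s≤s; z≤n; _!)
open import Data.Nat.Divisibility using (divides; m∣m*n; m≤n⇒m!∣n!; ∣-trans)
open import Data.Nat.Induction using (<-rec)
import Data.Nat.Properties as ℕ
open import Data.Nat.Tactic.RingSolver using (solve-∀)
open import Data.Product.Base using (Σ; ∃; ∃₂; _×_; _,_; proj₁; proj₂; swap)
open import Data.Vec.Base as Vec using (Vec; []; _∷_; lookup)
open import Data.Vec.Functional using (removeAt)
open import Function.Bundles using (_⇔_; mk⇔)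
open import Level using (Level; _⊔_)
open import Relation.Binary.PropositionalEquality as ≡ using (_≡_; _≢_)
open import Relation.Nullary using (contradiction; no; yes)

open CommutativeMonoidSum ℕ.+-0-commutativeMonoid using ()
  renaming (sum to sumℕ; sum-remove to sumℕ-remove)

-- Determinization over a finite subsemiring.

module LocallyFiniteClosed {c ℓ} (S : Semiring c ℓ) where

  open import Data.List.Membership.Propositional using (_∈_)
  open Semiring S hiding (zero)
  open import Algebra.Properties.Semiring.Sum S
  open import Relation.Binary.Reasoning.Setoid setoid

  sumVec-cong : ∀ {n} k {f g : Vec (Fin n) k → Carrier} → (∀ ps → f ps ≈ g ps) →
    sumVec S k f ≈ sumVec S k g
  sumVec-cong zero    f≈g = f≈g []
  sumVec-cong (suc k) f≈g = sum-cong-≋ (λ p → sumVec-cong k (λ ps → f≈g (p ∷ ps)))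

  generated-sum : ∀ {X n} {f : Fin n → Carrier} →
    (∀ p → Generated S X (f p)) → Generated S X (sum f)
  generated-sum {n = zero}  f∈ = zero
  generated-sum {n = suc n} f∈ = add (f∈ zero) (generated-sum (λ p → f∈ (suc p)))

  generated-sumVec : ∀ {X n} k {f : Vec (Fin n) k → Carrier} →
    (∀ ps → Generated S X (f ps)) → Generated S X (sumVec S k f)
  generated-sumVec zero    f∈ = f∈ []
  generated-sumVec (suc k) f∈ = generated-sum (λ p → generated-sumVec k (λ ps → f∈ (p ∷ ps)))

  kronecker : ∀ {n} → Fin n → Fin n → Carrier
  kronecker zero    zero    = 1#
  kronecker zero    (suc _) = 0#
  kronecker (suc _) zero    = 0#
  kronecker (suc p) (suc q) = kronecker p q

  sum-kronecker : ∀ {n} (f : Fin n → Carrier) r → sum (λ p → f p * kronecker r p) ≈ f r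
  sum-kronecker {suc n} f zero = begin
    f zero * 1# + sum (λ p → f (suc p) * 0#)
      ≈⟨ +-cong (*-identityʳ _) (sum-cong-≋ (λ p → zeroʳ (f (suc p)))) ⟩
    f zero + sum {n} (λ _ → 0#)  ≈⟨ +-congˡ (sum-replicate-zero n) ⟩
    f zero + 0#                  ≈⟨ +-identityʳ _ ⟩
    f zero                       ∎
  sum-kronecker {suc n} f (suc r) = begin
    f zero * 0# + sum (λ p → f (suc p) * kronecker r p)
      ≈⟨ +-cong (zeroʳ _) (sum-kronecker (λ p → f (suc p)) r) ⟩
    0# + f (suc r)  ≈⟨ +-identityˡ _ ⟩
    f (suc r)       ∎

  allVecs : ∀ n k → List (Vec (Fin n) k)
  allVecs n zero    = [] ∷ []
  allVecs n (suc k) = cartesianProductWith _∷_ (allFin n) (allVecs n k)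

  ∈-allVecs : ∀ {n k} (ps : Vec (Fin n) k) → ps ∈ allVecs n k
  ∈-allVecs []       = here ≡.refl
  ∈-allVecs (p ∷ ps) = ∈-cartesianProductWith⁺ _∷_ (∈-allFin p) (∈-allVecs ps)

  module _ {Γ : RankedAlphabet} (A : WFTA S Γ) where

    open WFTA A

    mutual
      -- The state behaviors of a substituted term depend on the substituted trees only through
      -- their state behaviors; `ρ` holds these, one vector per variable.
      eval : ∀ {n} → Term Γ n → (Fin n → Fin states → Carrier) → Fin states → Carrier
      eval (var i)     ρ q = ρ i q
      eval (node g ts) ρ q = sumVec S (rank Γ g) (λ ps → δ g ps q * evalProduct ts ρ ps)

      evalProduct : ∀ {n k} → Vec (Term Γ n) k → (Fin n → Fin states → Carrier) →
        Vec (Fin states) k → Carrier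
      evalProduct []       ρ []       = 1#
      evalProduct (t ∷ ts) ρ (p ∷ ps) = eval t ρ p * evalProduct ts ρ ps

    mutual
      stateBehavior-⟨⟩ : ∀ {n} (s : Term Γ n) {us : Vec (Tree Γ) n} {ρ} →
        (∀ i q → stateBehavior S A (lookup us i) q ≈ ρ i q) →
        ∀ q → stateBehavior S A (s ⟨ us ⟩) q ≈ eval s ρ q
      stateBehavior-⟨⟩ (var i)     us≈ρ q = us≈ρ i q
      stateBehavior-⟨⟩ (node g ss) us≈ρ q =
        sumVec-cong (rank Γ g) (λ ps → *-congˡ (productBehavior-⟨⟩ ss us≈ρ ps))

      productBehavior-⟨⟩ : ∀ {n k} (ss : Vec (Term Γ n) k) {us : Vec (Tree Γ) n} {ρ} →
        (∀ i q → stateBehavior S A (lookup us i) q ≈ ρ i q) →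
        ∀ ps → productBehavior S A (ss ⟨ us ⟩*) ps ≈ evalProduct ss ρ ps
      productBehavior-⟨⟩ []       us≈ρ []       = refl
      productBehavior-⟨⟩ (s ∷ ss) us≈ρ (p ∷ ps) =
        *-cong (stateBehavior-⟨⟩ s us≈ρ p) (productBehavior-⟨⟩ ss us≈ρ ps)

    -- State behaviors are built from transition weights alone; `final` enters only after the values
    -- have been read off.
    weights : List Carrier
    weights = concatMap (λ g → concatMap (λ ps → map (δ g ps) (allFin states))
      (allVecs states (rank Γ g))) (allFin (size Γ))

    generated-weight : ∀ g ps q → Generated S weights (δ g ps q)
    generated-weight g ps q = gen (Any.map reflexive (∈-concatMap⁺ _ (Any.map
      (λ { ≡.refl → ∈-concatMap⁺ _ (Any.map
        (λ { ≡.refl → ∈-map⁺ (δ g ps) (∈-allFin q) }) (∈-allVecs ps)) }) (∈-allFin g))))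

    mutual
      generated-eval : ∀ {n} (s : Term Γ n) {ρ} → (∀ i q → Generated S weights (ρ i q)) →
        ∀ q → Generated S weights (eval s ρ q)
      generated-eval (var i)     ρ∈ q = ρ∈ i q
      generated-eval (node g ss) ρ∈ q = generated-sumVec (rank Γ g)
        (λ ps → mul (generated-weight g ps q) (generated-evalProduct ss ρ∈ ps))

      generated-evalProduct : ∀ {n k} (ss : Vec (Term Γ n) k) {ρ} →
        (∀ i q → Generated S weights (ρ i q)) →
        ∀ ps → Generated S weights (evalProduct ss ρ ps)
      generated-evalProduct []       ρ∈ []       = one
      generated-evalProduct (s ∷ ss) ρ∈ (p ∷ ps) =
        mul (generated-eval s ρ∈ p) (generated-evalProduct ss ρ∈ ps)

  locallyFinite⇒closed : LocallyFinite S → ClosedUnderInverseHomomorphisms S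
  locallyFinite⇒closed locallyFinite Λ Γ h isHom u (A , A≈u) =
    B , λ t → trans (behavior-B t) (A≈u (h t))
    where
    open WFTA A
    values     = proj₁ (locallyFinite (weights A))
    enumerates = proj₂ (locallyFinite (weights A))

    -- A state of B codes, for every state of A, an index into the list of values.
    DetState = Fin (length values ℕ.^ states)

    value : DetState → Fin states → Carrier
    value v q = proj₁ (List.lookup values (finToFun v q))

    generated-value : ∀ v q → Generated S (weights A) (value v q)
    generated-value v q = proj₂ (List.lookup values (finToFun v q))

    code : (f : Fin states → Carrier) → (∀ q → Generated S (weights A) (f q)) → DetState
    code f f∈ = funToFin (λ q → index (enumerates (f q , f∈ q)))

    value-code : ∀ f f∈ q → value (code f f∈) q ≈ f q
    value-code f f∈ q = begin
      value (code f f∈) q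
        ≡⟨ ≡.cong (λ i → proj₁ (List.lookup values i))
             (finToFun-funToFin (λ p → index (enumerates (f p , f∈ p))) q) ⟩
      proj₁ (List.lookup values (index (enumerates (f q , f∈ q))))
        ≈⟨ Any.lookup-index (enumerates (f q , f∈ q)) ⟨
      f q  ∎

    -- A child state is looked up and not summed over, so a variable repeated or omitted in
    -- `proj₁ (isHom g)` reuses or ignores one value and creates no cross terms.
    step : (g : Symbol Λ) → Vec DetState (rank Λ g) → DetState
    step g vs = code (eval A (proj₁ (isHom g)) (λ i → value (lookup vs i)))
      (generated-eval A (proj₁ (isHom g)) (λ i → generated-value (lookup vs i)))

    B : WFTA S Λ
    B = record
      { states = length values ℕ.^ states
      ; δ      = λ g vs → kronecker (step g vs)
      ; final  = λ v → sum (λ q → final q * value v q)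
      }

    mutual
      run : Tree Λ → DetState
      run (node g ts) = step g (runs ts)

      runs : ∀ {k} → Vec (Tree Λ) k → Vec DetState k
      runs []       = []
      runs (t ∷ ts) = run t ∷ runs ts

    mutual
      stateBehavior-B : ∀ t v → stateBehavior S B t v ≈ kronecker (run t) v
      stateBehavior-B (node g ts) v = sumVec-B ts (λ vs → kronecker (step g vs) v)

      -- Each subtree contributes a Kronecker delta that collapses one sum. The function `f` is
      -- arbitrary so that the induction can move the factor of the first subtree into it.
      sumVec-B : ∀ {k} (ts : Vec (Tree Λ) k) (f : Vec DetState k → Carrier) →
        sumVec S k (λ vs → f vs * productBehavior S B ts vs) ≈ f (runs ts)
      sumVec-B []               f = *-identityʳ (f [])
      sumVec-B {suc k} (t ∷ ts) f = begin
        sum (λ v → sumVec S k (λ vs → f (v ∷ vs) * (stateBehavior S B t v * productBehavior S B ts vs)))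
          ≈⟨ sum-cong-≋ (λ v → sumVec-cong k (λ vs → sym (*-assoc (f (v ∷ vs)) (stateBehavior S B t v) (productBehavior S B ts vs)))) ⟩
        sum (λ v → sumVec S k (λ vs → f (v ∷ vs) * stateBehavior S B t v * productBehavior S B ts vs))
          ≈⟨ sum-cong-≋ (λ v → sumVec-B ts (λ vs → f (v ∷ vs) * stateBehavior S B t v)) ⟩
        sum (λ v → f (v ∷ runs ts) * stateBehavior S B t v)
          ≈⟨ sum-cong-≋ (λ v → *-congˡ (stateBehavior-B t v)) ⟩
        sum (λ v → f (v ∷ runs ts) * kronecker (run t) v)
          ≈⟨ sum-kronecker (λ v → f (v ∷ runs ts)) (run t) ⟩
        f (run t ∷ runs ts)  ∎

    mutual
      value-run : ∀ t q → stateBehavior S A (h t) q ≈ value (run t) q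
      value-run (node g ts) q = begin
        stateBehavior S A (h (node g ts)) q
          ≡⟨ ≡.cong (λ t → stateBehavior S A t q) (proj₂ (isHom g) ts) ⟩
        stateBehavior S A (proj₁ (isHom g) ⟨ Vec.map h ts ⟩) q
          ≈⟨ stateBehavior-⟨⟩ A (proj₁ (isHom g)) (value-runs ts) q ⟩
        eval A (proj₁ (isHom g)) (λ i → value (lookup (runs ts) i)) q
          ≈⟨ value-code _ _ q ⟨
        value (step g (runs ts)) q  ∎

      value-runs : ∀ {k} (ts : Vec (Tree Λ) k) i q →
        stateBehavior S A (lookup (Vec.map h ts) i) q ≈ value (lookup (runs ts) i) q
      value-runs (t ∷ ts) zero    q = value-run t q
      value-runs (t ∷ ts) (suc i) q = value-runs ts i q

    behavior-B : ∀ t → behavior S B t ≈ behavior S A (h t)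
    behavior-B t = begin
      sum (λ v → sum (λ q → final q * value v q) * stateBehavior S B t v)
        ≈⟨ sum-cong-≋ (λ v → *-congˡ (stateBehavior-B t v)) ⟩
      sum (λ v → sum (λ q → final q * value v q) * kronecker (run t) v)
        ≈⟨ sum-kronecker (λ v → sum (λ q → final q * value v q)) (run t) ⟩
      sum (λ q → final q * value (run t) q)
        ≈⟨ sum-cong-≋ (λ q → *-congˡ (value-run t q)) ⟨
      behavior S A (h t)  ∎

-- Natural combinations of finitely many elements of a commutative monoid.

module Combinations {c ℓ} (M : CommutativeMonoid c ℓ) where

  open CommutativeMonoid M
  open import Algebra.Properties.CommutativeMonoid.Mult M
    using (×-homo-+; ×-cong) renaming (_×_ to _·_)
  open import Algebra.Properties.CommutativeSemigroup commutativeSemigroup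
    using (interchange)
  open import Data.List.Membership.Setoid setoid using (_∈_)
  open import Relation.Binary.Reasoning.Setoid setoid

  -- Read additively these are sums of multiples, read multiplicatively they are monomials.
  data Combination : List Carrier → Carrier → Set (c ⊔ ℓ) where
    []   : ∀ {u} → u ≈ ε → Combination [] u
    cons : ∀ {g gs u s} k → u ≈ k · g ∙ s → Combination gs s → Combination (g ∷ gs) u

  FiniteOrder : Carrier → Set ℓ
  FiniteOrder g = ∃₂ λ a b → a ℕ.< b × a · g ≈ b · g

  combination-resp : ∀ {gs u v} → u ≈ v → Combination gs u → Combination gs v
  combination-resp u≈v ([] p)       = [] (trans (sym u≈v) p)
  combination-resp u≈v (cons k p c) = cons k (trans (sym u≈v) p) c

  combination-ε : ∀ gs → Combination gs ε
  combination-ε []       = [] refl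
  combination-ε (g ∷ gs) = cons 0 (sym (identityˡ ε)) (combination-ε gs)

  combination-∈ : ∀ {gs u} → u ∈ gs → Combination gs u
  combination-∈ {g ∷ gs} {u} (here u≈g) = cons 1 (begin
    u          ≈⟨ u≈g ⟩
    g          ≈⟨ identityʳ g ⟨
    g ∙ ε      ≈⟨ identityʳ (g ∙ ε) ⟨
    1 · g ∙ ε  ∎) (combination-ε gs)
  combination-∈ (there i) = cons 0 (sym (identityˡ _)) (combination-∈ i)

  combination-∙ : ∀ {gs u v} → Combination gs u → Combination gs v → Combination gs (u ∙ v)
  combination-∙ ([] p) ([] q) = [] (trans (∙-cong p q) (identityˡ ε))
  combination-∙ {g ∷ _} {u} {v} (cons {s = s} k p c) (cons {s = t} k′ q d) =
    cons (k ℕ.+ k′) (begin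
      u ∙ v                      ≈⟨ ∙-cong p q ⟩
      k · g ∙ s ∙ (k′ · g ∙ t)   ≈⟨ interchange _ _ _ _ ⟩
      k · g ∙ k′ · g ∙ (s ∙ t)   ≈⟨ ∙-congʳ (×-homo-+ g k k′) ⟨
      (k ℕ.+ k′) · g ∙ (s ∙ t)   ∎) (combination-∙ c d)

  combination-elim : ∀ {p gs} (P : Carrier → Set p) → (∀ {u v} → u ≈ v → P u → P v) →
    P ε → (∀ {u v} → P u → P v → P (u ∙ v)) → (∀ {u} → u ∈ gs → P u) →
    ∀ {u} → Combination gs u → P u
  combination-elim P P≈ Pε P∙ P∈ ([] p) = P≈ (sym p) Pε
  combination-elim P P≈ Pε P∙ P∈ (cons {g} k p c) =
    P≈ (sym p) (P∙ (P· k) (combination-elim P P≈ Pε P∙ (λ i → P∈ (there i)) c))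
    where
    P· : ∀ k → P (k · g)
    P· zero    = Pε
    P· (suc k) = P∙ (P∈ (here refl)) (P· k)

  -- As long as `k` is at least `b`, trading `b` copies of `g` for `a` copies lowers the
  -- coefficient.
  reduceMultiple : ∀ {g a b} → a ℕ.< b → a · g ≈ b · g → ∀ k → ∃ λ j → j ℕ.< b × k · g ≈ j · g
  reduceMultiple {g} {a} {b} a<b ag≈bg = <-rec _ λ k rec → go k rec
    where
    go : ∀ k → (∀ {k′} → k′ ℕ.< k → ∃ λ j → j ℕ.< b × k′ · g ≈ j · g) →
         ∃ λ j → j ℕ.< b × k · g ≈ j · g
    go k rec with k ℕ.<? b
    ... | yes k<b = k , k<b , refl
    ... | no  k≮b =
      let b≤k           = ℕ.≮⇒≥ k≮b
          j , j<b , eq  = rec {k ℕ.∸ b ℕ.+ a} (ℕ.<-≤-trans (ℕ.+-monoʳ-< (k ℕ.∸ b) a<b) (ℕ.≤-reflexive (ℕ.m∸n+n≡m b≤k)))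
      in j , j<b , (begin
        k · g                        ≈⟨ ×-cong (ℕ.m∸n+n≡m b≤k) refl ⟨
        (k ℕ.∸ b ℕ.+ b) · g          ≈⟨ ×-homo-+ g (k ℕ.∸ b) b ⟩
        (k ℕ.∸ b) · g ∙ b · g        ≈⟨ ∙-congˡ ag≈bg ⟨
        (k ℕ.∸ b) · g ∙ a · g        ≈⟨ ×-homo-+ g (k ℕ.∸ b) a ⟨
        (k ℕ.∸ b ℕ.+ a) · g          ≈⟨ eq ⟩
        j · g                        ∎)

  combinations : ∀ {gs} → All FiniteOrder gs → List (∃ (Combination gs))
  combinations []                        = (ε , [] refl) ∷ []
  combinations {g ∷ _} ((a , b , _) ∷ o) =
    cartesianProductWith (λ k (s , c) → k · g ∙ s , cons k refl c) (upTo b) (combinations o)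

  combinations-complete : ∀ {gs} (o : All FiniteOrder gs) {u} → Combination gs u →
    Any (λ v → u ≈ proj₁ v) (combinations o)
  combinations-complete [] ([] p) = here p
  combinations-complete ((a , b , a<b , eq) ∷ o) (cons k p c) =
    let j , j<b , eq′ = reduceMultiple a<b eq k in
    Any.cartesianProductWith⁺ _
      (λ { ≡.refl q → trans p (∙-cong eq′ q) })
      (∈-upTo⁺ j<b) (combinations-complete o c)

-- The Hankel matrix of a tree language on chains.

module HankelRank {c ℓ} (S : CommutativeSemiring c ℓ) where

  open CommutativeSemiring S hiding (zero)
  open import Algebra.Properties.Semiring.Sum semiring
  open import Algebra.Properties.CommutativeSemiring.Exp S
  open import Algebra.Solver.Ring.NaturalCoefficients.Default S using (solve; _:=_; _:+_; _:*_; con)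
  open import Relation.Binary.Reasoning.Setoid setoid

  -- A factorization rank: the infinite matrix is a product with inner dimension `n`. With base 4
  -- the exponents grow so fast that crude estimates suffice to compare products of entries.
  HankelRank : ℕ → Carrier → Set _
  HankelRank n x = Σ (ℕ → Fin n → Carrier) λ l → Σ (ℕ → Fin n → Carrier) λ r →
    ∀ i j → sum (λ k → l i k * r j k) ≈ x ^ (4 ℕ.^ (i ℕ.+ j))

  -- Dropping the first `m` rows multiplies every exponent by `4 ^ m`.
  hankelRank-power : ∀ {n x} m → HankelRank n x → HankelRank n (x ^ (4 ℕ.^ m))
  hankelRank-power {n} {x} m (l , r , lr) = (λ i → l (m ℕ.+ i)) , r , λ i j → begin
    sum (λ k → l (m ℕ.+ i) k * r j k)    ≈⟨ lr (m ℕ.+ i) j ⟩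
    x ^ (4 ℕ.^ (m ℕ.+ i ℕ.+ j))          ≈⟨ ^-congʳ x (≡.cong (4 ℕ.^_) (ℕ.+-assoc m i j)) ⟩
    x ^ (4 ℕ.^ (m ℕ.+ (i ℕ.+ j)))        ≈⟨ ^-congʳ x (ℕ.^-distribˡ-+-* 4 m (i ℕ.+ j)) ⟩
    x ^ (4 ℕ.^ m ℕ.* 4 ℕ.^ (i ℕ.+ j))    ≈⟨ ^-assocʳ x (4 ℕ.^ m) (4 ℕ.^ (i ℕ.+ j)) ⟨
    (x ^ (4 ℕ.^ m)) ^ (4 ℕ.^ (i ℕ.+ j))  ∎

  leafAndSymbolOfRank : ℕ → RankedAlphabet
  leafAndSymbolOfRank k = record
    { size = 2 ; nonEmpty = _ ; rank = λ { zero → 0 ; (suc zero) → k } }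

  private
    Λ = leafAndSymbolOfRank 1
    Γ = leafAndSymbolOfRank 4

  duplicate : Tree Λ → Tree Γ
  duplicate (node zero [])             = node zero []
  duplicate (node (suc zero) (t ∷ [])) = node (suc zero) (s ∷ s ∷ s ∷ s ∷ [])
    where s = duplicate t

  duplicate-isTreeHomomorphism : IsTreeHomomorphism Λ Γ duplicate
  duplicate-isTreeHomomorphism zero       = node zero [] , λ { [] → ≡.refl }
  duplicate-isTreeHomomorphism (suc zero) =
    node (suc zero) (var zero ∷ var zero ∷ var zero ∷ var zero ∷ []) , λ { (_ ∷ []) → ≡.refl }

  chain : ℕ → Tree Λ
  chain zero    = node zero []
  chain (suc m) = node (suc zero) (chain m ∷ [])

  leafPower : Carrier → WFTA semiring Γ
  leafPower x = record
    { states = 1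
    ; δ      = λ { zero _ _ → x ; (suc zero) _ _ → 1# }
    ; final  = λ _ → 1#
    }

  stateBehavior-leafPower : ∀ x m →
    stateBehavior semiring (leafPower x) (duplicate (chain m)) zero ≈ x ^ (4 ℕ.^ m)
  stateBehavior-leafPower x zero    = refl
  stateBehavior-leafPower x (suc m) = begin
    1# * (v * (v * (v * (v * 1#)))) + 0# + 0# + 0# + 0#
      ≈⟨ solve 1 (λ v → con 1 :* (v :* (v :* (v :* (v :* con 1)))) :+ con 0 :+ con 0 :+ con 0 :+ con 0
           := v :* (v :* (v :* (v :* con 1)))) refl v ⟩
    v ^ 4                     ≈⟨ ^-congˡ 4 (stateBehavior-leafPower x m) ⟩
    (x ^ (4 ℕ.^ m)) ^ 4       ≈⟨ ^-assocʳ x (4 ℕ.^ m) 4 ⟩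
    x ^ (4 ℕ.^ m ℕ.* 4)       ≈⟨ ^-congʳ x (ℕ.*-comm (4 ℕ.^ m) 4) ⟩
    x ^ (4 ℕ.^ suc m)         ∎
    where v = stateBehavior semiring (leafPower x) (duplicate (chain m)) zero

  -- Cutting a chain of `i + j` unary symbols leaves a row vector for the upper `i` symbols and a
  -- column vector for the lower `j`, both indexed by the states of the automaton for the inverse
  -- image.
  closed⇒hankelRank : ClosedUnderInverseHomomorphisms semiring → ∀ x → ∃ λ n → HankelRank n x
  closed⇒hankelRank closed x = states , left , right , hankel
    where
    recognizable = closed Λ Γ duplicate duplicate-isTreeHomomorphism
      (behavior semiring (leafPower x)) (leafPower x , λ _ → refl)
    B = proj₁ recognizable
    open WFTA B

    left : ℕ → Fin states → Carrier
    left zero    p = final p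
    left (suc i) p = sum (λ q → left i q * δ (suc zero) (p ∷ []) q)

    right : ℕ → Fin states → Carrier
    right j = stateBehavior semiring B (chain j)

    -- Associativity of row vector, transition matrix and column vector: one symbol crosses the cut.
    shift : ∀ i j → sum (λ p → left (suc i) p * right j p) ≈ sum (λ q → left i q * right (suc j) q)
    shift i j = begin
      sum (λ p → sum (λ q → left i q * δ₁ p q) * right j p)
        ≈⟨ sum-cong-≋ (λ p → *-distribʳ-sum (right j p) (λ q → left i q * δ₁ p q)) ⟩
      sum (λ p → sum (λ q → left i q * δ₁ p q * right j p))
        ≈⟨ ∑-comm (λ p q → left i q * δ₁ p q * right j p) ⟩
      sum (λ q → sum (λ p → left i q * δ₁ p q * right j p))
        ≈⟨ sum-cong-≋ (λ q → sum-cong-≋ (λ p → trans (*-assoc (left i q) (δ₁ p q) (right j p))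
             (*-congˡ (*-congˡ (sym (*-identityʳ (right j p))))))) ⟩
      sum (λ q → sum (λ p → left i q * (δ₁ p q * (right j p * 1#))))
        ≈⟨ sum-cong-≋ (λ q → *-distribˡ-sum (left i q) (λ p → δ₁ p q * (right j p * 1#))) ⟨
      sum (λ q → left i q * right (suc j) q)  ∎
      where
      δ₁ : Fin states → Fin states → Carrier
      δ₁ p q = δ (suc zero) (p ∷ []) q

    hankel : ∀ i j → sum (λ k → left i k * right j k) ≈ x ^ (4 ℕ.^ (i ℕ.+ j))
    hankel zero j = begin
      behavior semiring B (chain j)
        ≈⟨ proj₂ recognizable (chain j) ⟩
      1# * stateBehavior semiring (leafPower x) (duplicate (chain j)) zero + 0#
        ≈⟨ trans (+-identityʳ _) (*-identityˡ _) ⟩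
      stateBehavior semiring (leafPower x) (duplicate (chain j)) zero
        ≈⟨ stateBehavior-leafPower x j ⟩
      x ^ (4 ℕ.^ j)  ∎
    hankel (suc i) j = begin
      sum (λ p → left (suc i) p * right j p)  ≈⟨ shift i j ⟩
      sum (λ q → left i q * right (suc j) q)  ≈⟨ hankel i (suc j) ⟩
      x ^ (4 ℕ.^ (i ℕ.+ suc j))               ≈⟨ ^-congʳ x (≡.cong (4 ℕ.^_) (ℕ.+-suc i j)) ⟩
      x ^ (4 ℕ.^ suc (i ℕ.+ j))               ∎

-- Degree estimates for the minors.

degreeBound : List ℕ → ℕ → ℕ
degreeBound []       j = 0
degreeBound (i ∷ is) j = 4 ℕ.^ (i ℕ.+ j) ℕ.+ degreeBound is j

-- `degreeBound` allots to each row its entry in the largest column `j`; over consecutive rows this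
-- is a geometric sum, stated without division.
degreeBound-downFrom : ∀ m j → 3 ℕ.* degreeBound (downFrom m) j ℕ.+ 4 ℕ.^ j ≡ 4 ℕ.^ (m ℕ.+ j)
degreeBound-downFrom zero    j = ≡.refl
degreeBound-downFrom (suc m) j = ≡.trans (lemma (4 ℕ.^ (m ℕ.+ j)) (degreeBound (downFrom m) j) (4 ℕ.^ j))
  (≡.trans (≡.cong (3 ℕ.* 4 ℕ.^ (m ℕ.+ j) ℕ.+_) (degreeBound-downFrom m j)) (lemma′ (4 ℕ.^ (m ℕ.+ j))))
  where
  lemma : ∀ a b c → 3 ℕ.* (a ℕ.+ b) ℕ.+ c ≡ 3 ℕ.* a ℕ.+ (3 ℕ.* b ℕ.+ c)
  lemma = solve-∀
  lemma′ : ∀ a → 3 ℕ.* a ℕ.+ a ≡ 4 ℕ.* a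
  lemma′ = solve-∀

-- With `a = 4 ^ (2j + 1)` the second summand is below `4a / 3`, so the left side is below `7a / 3`,
-- while the right side is `4a`. The left side bounds the terms that avoid the diagonal entry of the
-- top row `suc j`.
offDiagonal< : ∀ j →
  4 ℕ.^ (suc j ℕ.+ j) ℕ.+ degreeBound (downFrom (suc j)) (suc j) ℕ.< 4 ℕ.^ (suc j ℕ.+ suc j)
offDiagonal< j = ℕ.*-cancelˡ-< 3 _ _ (begin-strict
  3 ℕ.* (a ℕ.+ b)                     ≡⟨ ℕ.*-distribˡ-+ 3 a b ⟩
  3 ℕ.* a ℕ.+ 3 ℕ.* b                 <⟨ ℕ.+-monoʳ-< (3 ℕ.* a) (ℕ.m<m+n (3 ℕ.* b) (ℕ.m^n>0 4 (suc j))) ⟩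
  3 ℕ.* a ℕ.+ (3 ℕ.* b ℕ.+ 4 ℕ.^ suc j) ≡⟨ ≡.cong (3 ℕ.* a ℕ.+_) (degreeBound-downFrom (suc j) (suc j)) ⟩
  3 ℕ.* a ℕ.+ d                       ≡⟨ ≡.cong (λ k → 3 ℕ.* a ℕ.+ 4 ℕ.^ k) (ℕ.+-suc (suc j) j) ⟩
  3 ℕ.* a ℕ.+ 4 ℕ.* a                 ≤⟨ ℕ.m≤m+n _ (5 ℕ.* a) ⟩
  3 ℕ.* a ℕ.+ 4 ℕ.* a ℕ.+ 5 ℕ.* a     ≡⟨ lemma a ⟩
  3 ℕ.* (4 ℕ.* a)                     ≡⟨ ≡.cong (λ k → 3 ℕ.* 4 ℕ.^ k) (ℕ.+-suc (suc j) j) ⟨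
  3 ℕ.* d                             ∎)
  where
  open ℕ.≤-Reasoning
  a = 4 ℕ.^ (suc j ℕ.+ j)
  b = degreeBound (downFrom (suc j)) (suc j)
  d = 4 ℕ.^ (suc j ℕ.+ suc j)
  lemma : ∀ a → 3 ℕ.* a ℕ.+ 4 ℕ.* a ℕ.+ 5 ℕ.* a ≡ 3 ℕ.* (4 ℕ.* a)
  lemma = solve-∀

downFrom-≤ : ∀ m → All (ℕ._≤ m) (downFrom (suc m))
downFrom-≤ zero    = z≤n ∷ []
downFrom-≤ (suc m) = ℕ.≤-refl ∷ All.map ℕ.m≤n⇒m≤1+n (downFrom-≤ m)

-- Determinants over a semiring as formal differences.

module Determinant {c ℓ} (S : CommutativeSemiring c ℓ) where

  open CommutativeSemiring S hiding (zero)
  open HankelRank S using (HankelRank)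
  open import Algebra.Properties.Semiring.Sum semiring
  open import Algebra.Properties.CommutativeSemiring.Exp S
  open import Algebra.Properties.CommutativeSemigroup *-commutativeSemigroup using (x∙yz≈y∙xz)

  -- The pair (p , q) stands for the formal difference p − q.
  signed : CommutativeMonoid _ _
  signed = DirectProduct.commutativeMonoid +-commutativeMonoid +-commutativeMonoid

  open CommutativeMonoid signed public using () renaming
    ( Carrier to Signed; _≈_ to _≋_; _∙_ to _⊕_; ε to 0±; setoid to ≋-setoid
    ; refl to ≋-refl; sym to ≋-sym; trans to ≋-trans; ∙-cong to ⊕-cong; ∙-congˡ to ⊕-congˡ
    ; identityˡ to ⊕-identityˡ; commutativeSemigroup to ⊕-commutativeSemigroup)
  open import Algebra.Properties.CommutativeSemigroup ⊕-commutativeSemigroup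
    using (interchange) renaming (x∙yz≈y∙xz to x⊕[y⊕z]≋y⊕[x⊕z])
  open import Relation.Binary.Reasoning.Setoid ≋-setoid

  infixr 8 _◃_

  _◃_ : Carrier → Signed → Signed
  a ◃ (p , q) = a * p , a * q

  -- Being `swap`, `neg` is an involution and passes through `_⊕_` and `_◃_` by computation; the
  -- proofs below use this silently.
  neg : Signed → Signed
  neg = swap

  neg-cong : ∀ {s t} → s ≋ t → neg s ≋ neg t
  neg-cong = swap

  ◃-cong : ∀ {a b s t} → a ≈ b → s ≋ t → a ◃ s ≋ b ◃ t
  ◃-cong a≈b (p , q) = *-cong a≈b p , *-cong a≈b q

  ◃-congˡ : ∀ {a s t} → s ≋ t → a ◃ s ≋ a ◃ t
  ◃-congˡ = ◃-cong refl

  -- Signed sum over all ways of removing one entry from a list (cofactor expansion).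
  alternate : List ℕ → (ℕ → List ℕ → Signed) → Signed
  alternate []       f = 0±
  alternate (c ∷ cs) f = f c cs ⊕ neg (alternate cs (λ c′ cs′ → f c′ (c ∷ cs′)))

  alternate-cong : ∀ cs {f g} → (∀ c cs′ → f c cs′ ≋ g c cs′) → alternate cs f ≋ alternate cs g
  alternate-cong []       f≋g = ≋-refl
  alternate-cong (c ∷ cs) f≋g =
    ⊕-cong (f≋g c cs) (neg-cong (alternate-cong cs (λ c′ cs′ → f≋g c′ (c ∷ cs′))))

  alternate-⊕ : ∀ cs f g →
    alternate cs (λ c cs′ → f c cs′ ⊕ g c cs′) ≋ alternate cs f ⊕ alternate cs g
  alternate-⊕ []       f g = ≋-sym (⊕-identityˡ _)
  alternate-⊕ (c ∷ cs) f g = ≋-trans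
    (⊕-congˡ (neg-cong (alternate-⊕ cs (λ c′ cs′ → f c′ (c ∷ cs′)) (λ c′ cs′ → g c′ (c ∷ cs′)))))
    (interchange _ _ _ _)

  alternate-neg : ∀ cs f → alternate cs (λ c cs′ → neg (f c cs′)) ≋ neg (alternate cs f)
  alternate-neg []       f = ≋-refl
  alternate-neg (c ∷ cs) f = ⊕-congˡ (neg-cong (alternate-neg cs (λ c′ cs′ → f c′ (c ∷ cs′))))

  alternate-◃ : ∀ cs a f → alternate cs (λ c cs′ → a ◃ f c cs′) ≋ a ◃ alternate cs f
  alternate-◃ []       a f = sym (zeroʳ a) , sym (zeroʳ a)
  alternate-◃ (c ∷ cs) a f = ≋-trans
    (⊕-congˡ (neg-cong (alternate-◃ cs a (λ c′ cs′ → f c′ (c ∷ cs′)))))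
    (sym (distribˡ a _ _) , sym (distribˡ a _ _))

  -- Two entries chosen in either order get opposite signs. The induction separates the terms where
  -- `a` is chosen first (`A₁`), second (`A₂`), or not at all; only the last kind needs the
  -- induction hypothesis.
  alternate-swap : ∀ cs (f : ℕ → ℕ → List ℕ → Signed) →
    alternate cs (λ c cs′ → alternate cs′ (f c)) ≋
    neg (alternate cs (λ c cs′ → alternate cs′ (λ c′ → f c′ c)))
  alternate-swap []       f = ≋-refl
  alternate-swap (a ∷ cs) f = begin
    A₁ ⊕ neg (alternate cs (λ c cs′ → f c a cs′ ⊕ neg (alternate cs′ (g c))))
      ≈⟨ ⊕-congˡ (neg-cong (expand f)) ⟩
    A₁ ⊕ (neg A₂ ⊕ alternate cs (λ c cs′ → alternate cs′ (g c)))
      ≈⟨ x⊕[y⊕z]≋y⊕[x⊕z] _ _ _ ⟩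
    neg A₂ ⊕ (A₁ ⊕ alternate cs (λ c cs′ → alternate cs′ (g c)))
      ≈⟨ ⊕-congˡ (⊕-congˡ (alternate-swap cs g)) ⟩
    neg (A₂ ⊕ neg (A₁ ⊕ neg (alternate cs (λ c cs′ → alternate cs′ (λ c′ → g c′ c)))))
      ≈⟨ neg-cong (⊕-congˡ (neg-cong (expand (λ c c′ → f c′ c)))) ⟨
    neg (A₂ ⊕ neg (alternate cs (λ c cs′ → f a c cs′ ⊕ neg (alternate cs′ (λ c′ → g c′ c)))))
      ∎
    where
    A₁ = alternate cs (f a)
    A₂ = alternate cs (λ c → f c a)
    g : ℕ → ℕ → List ℕ → Signed
    g c c′ cs″ = f c c′ (a ∷ cs″)

    expand : ∀ (f : ℕ → ℕ → List ℕ → Signed) →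
      alternate cs (λ c cs′ → f c a cs′ ⊕ neg (alternate cs′ (λ c′ cs″ → f c c′ (a ∷ cs″)))) ≋
      alternate cs (λ c → f c a) ⊕
        neg (alternate cs (λ c cs′ → alternate cs′ (λ c′ cs″ → f c c′ (a ∷ cs″))))
    expand f = ≋-trans
      (alternate-⊕ cs (λ c → f c a) (λ c cs′ → neg (alternate cs′ (λ c′ cs″ → f c c′ (a ∷ cs″)))))
      (⊕-congˡ (alternate-neg cs (λ c cs′ → alternate cs′ (λ c′ cs″ → f c c′ (a ∷ cs″)))))

  Row : Set c
  Row = ℕ → Carrier

  -- Laplace expansion along the first row. The number of columns is left free, so that statements
  -- about all column lists can be proved by induction on the rows; the square case is the
  -- determinant.
  det : List Row → List ℕ → Signed
  det []       cs = 1# , 0#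
  det (u ∷ us) cs = alternate cs (λ c cs′ → u c ◃ det us cs′)

  det-swap : ∀ u v us cs → det (u ∷ v ∷ us) cs ≋ neg (det (v ∷ u ∷ us) cs)
  det-swap u v us cs = begin
    alternate cs (λ c cs′ → u c ◃ alternate cs′ (λ c′ cs″ → v c′ ◃ det us cs″))
      ≈⟨ alternate-cong cs (λ c cs′ → alternate-◃ cs′ (u c) (λ c′ cs″ → v c′ ◃ det us cs″)) ⟨
    alternate cs (λ c cs′ → alternate cs′ (λ c′ cs″ → u c ◃ v c′ ◃ det us cs″))
      ≈⟨ alternate-swap cs (λ c c′ cs″ → u c ◃ v c′ ◃ det us cs″) ⟩
    neg (alternate cs (λ c cs′ → alternate cs′ (λ c′ cs″ → u c′ ◃ v c ◃ det us cs″)))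
      ≈⟨ neg-cong (alternate-cong cs (λ c cs′ → ≋-trans
           (alternate-cong cs′ (λ c′ cs″ → x∙yz≈y∙xz (u c′) (v c) _ , x∙yz≈y∙xz (u c′) (v c) _))
           (alternate-◃ cs′ (v c) (λ c′ cs″ → u c′ ◃ det us cs″)))) ⟩
    neg (det (v ∷ u ∷ us) cs)  ∎

  -- The row `a * b c + v c` has the shape in which a `sum` over `Fin (suc n)` unfolds.
  det-linear : ∀ us a b v ws cs → det (us ++ (λ c → a * b c + v c) ∷ ws) cs ≋
    a ◃ det (us ++ b ∷ ws) cs ⊕ det (us ++ v ∷ ws) cs
  det-linear [] a b v ws cs = begin
    alternate cs (λ c cs′ → (a * b c + v c) ◃ det ws cs′)
      ≈⟨ alternate-cong cs (λ c cs′ → split (b c) (v c) , split (b c) (v c)) ⟩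
    alternate cs (λ c cs′ → a ◃ b c ◃ det ws cs′ ⊕ v c ◃ det ws cs′)
      ≈⟨ alternate-⊕ cs (λ c cs′ → a ◃ b c ◃ det ws cs′) (λ c cs′ → v c ◃ det ws cs′) ⟩
    alternate cs (λ c cs′ → a ◃ b c ◃ det ws cs′) ⊕ det (v ∷ ws) cs
      ≈⟨ ⊕-cong (alternate-◃ cs a (λ c cs′ → b c ◃ det ws cs′)) ≋-refl ⟩
    a ◃ det (b ∷ ws) cs ⊕ det (v ∷ ws) cs  ∎
    where
    split : ∀ y z {w} → (a * y + z) * w ≈ a * (y * w) + z * w
    split y z = trans (distribʳ _ _ _) (+-congʳ (*-assoc a y _))
  det-linear (u ∷ us) a b v ws cs = begin
    alternate cs (λ c cs′ → u c ◃ det (us ++ (λ c → a * b c + v c) ∷ ws) cs′)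
      ≈⟨ alternate-cong cs (λ c cs′ → ≋-trans (◃-congˡ (det-linear us a b v ws cs′))
           (split (u c) , split (u c))) ⟩
    alternate cs (λ c cs′ → a ◃ u c ◃ det (us ++ b ∷ ws) cs′ ⊕ u c ◃ det (us ++ v ∷ ws) cs′)
      ≈⟨ alternate-⊕ cs (λ c cs′ → a ◃ u c ◃ det (us ++ b ∷ ws) cs′)
                        (λ c cs′ → u c ◃ det (us ++ v ∷ ws) cs′) ⟩
    alternate cs (λ c cs′ → a ◃ u c ◃ det (us ++ b ∷ ws) cs′) ⊕ det (u ∷ us ++ v ∷ ws) cs
      ≈⟨ ⊕-cong (alternate-◃ cs a (λ c cs′ → u c ◃ det (us ++ b ∷ ws) cs′)) ≋-refl ⟩
    a ◃ det (u ∷ us ++ b ∷ ws) cs ⊕ det (u ∷ us ++ v ∷ ws) cs  ∎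
    where
    split : ∀ y {w z} → y * (a * w + z) ≈ a * (y * w) + y * z
    split y = trans (distribˡ _ _ _) (+-congʳ (x∙yz≈y∙xz y a _))

  det-zero : ∀ us ws cs → det (us ++ (λ _ → 0#) ∷ ws) cs ≋ 0±
  det-zero us ws cs = begin
    det (us ++ (λ _ → 0#) ∷ ws) cs  ≈⟨ go us cs ⟩
    0# ◃ (0# , 0#)                  ≈⟨ zeroˡ 0# , zeroˡ 0# ⟩
    0±                              ∎
    where
    go : ∀ us cs → det (us ++ (λ _ → 0#) ∷ ws) cs ≋ 0# ◃ 0±
    go [] cs = begin
      alternate cs (λ c cs′ → 0# ◃ det ws cs′)
        ≈⟨ alternate-◃ cs 0# (λ c cs′ → det ws cs′) ⟩
      0# ◃ alternate cs (λ c cs′ → det ws cs′)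
        ≈⟨ trans (zeroˡ _) (sym (zeroˡ _)) , trans (zeroˡ _) (sym (zeroˡ _)) ⟩
      0# ◃ 0±  ∎
    go (u ∷ us) cs = begin
      alternate cs (λ c cs′ → u c ◃ det (us ++ (λ _ → 0#) ∷ ws) cs′)
        ≈⟨ alternate-cong cs (λ c cs′ → ≋-trans (◃-congˡ (go us cs′))
             (x∙yz≈y∙xz (u c) 0# 0# , x∙yz≈y∙xz (u c) 0# 0#)) ⟩
      alternate cs (λ c cs′ → 0# ◃ u c ◃ 0±)
        ≈⟨ alternate-◃ cs 0# (λ c cs′ → u c ◃ 0±) ⟩
      0# ◃ alternate cs (λ c cs′ → u c ◃ 0±)
        ≈⟨ trans (zeroˡ _) (sym (zeroˡ _)) , trans (zeroˡ _) (sym (zeroˡ _)) ⟩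
      0# ◃ 0±  ∎

  -- The formal difference det us vanishes.
  Balanced : List Row → Set ℓ
  Balanced us = ∀ cs → det us cs ≋ neg (det us cs)

  balanced-∷ : ∀ u us → Balanced us → Balanced (u ∷ us)
  balanced-∷ u us bal cs = ≋-trans
    (alternate-cong cs (λ c cs′ → ◃-congˡ (bal cs′)))
    (alternate-neg cs (λ c cs′ → u c ◃ det us cs′))

  balanced-swap : ∀ u v us → Balanced (v ∷ u ∷ us) → Balanced (u ∷ v ∷ us)
  balanced-swap u v us bal cs = begin
    det (u ∷ v ∷ us) cs        ≈⟨ det-swap u v us cs ⟩
    neg (det (v ∷ u ∷ us) cs)  ≈⟨ neg-cong (bal cs) ⟩
    det (v ∷ u ∷ us) cs        ≈⟨ neg-cong (det-swap u v us cs) ⟨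
    neg (det (u ∷ v ∷ us) cs)  ∎

  balanced-combination : ∀ {n} us (a : Fin n → Carrier) (b : Fin n → Row) ws →
    (∀ k → Balanced (us ++ b k ∷ ws)) →
    Balanced (us ++ (λ c → sum (λ k → a k * b k c)) ∷ ws)
  balanced-combination {zero}  us a b ws bal cs =
    ≋-trans (det-zero us ws cs) (neg-cong (≋-sym (det-zero us ws cs)))
  balanced-combination {suc n} us a b ws bal cs = begin
    det (us ++ (λ c → sum (λ k → a k * b k c)) ∷ ws) cs
      ≈⟨ det-linear us (a zero) (b zero) _ ws cs ⟩
    a zero ◃ det (us ++ b zero ∷ ws) cs ⊕ det (us ++ rest ∷ ws) cs
      ≈⟨ ⊕-cong (◃-congˡ (bal zero cs)) (balanced-combination us _ _ ws (λ k → bal (suc k)) cs) ⟩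
    neg (a zero ◃ det (us ++ b zero ∷ ws) cs ⊕ det (us ++ rest ∷ ws) cs)
      ≈⟨ neg-cong (det-linear us (a zero) (b zero) _ ws cs) ⟨
    neg (det (us ++ (λ c → sum (λ k → a k * b k c)) ∷ ws) cs)  ∎
    where
    rest : Row
    rest c = sum (λ k → a (suc k) * b (suc k) c)

  module _ {n : ℕ} (r : Fin n → Row) where

    -- If the equal row is adjacent, `det-swap` of the two is already the claim; otherwise the head
    -- is exchanged with its neighbour and comes one place closer.
    balanced-repeatedHead : ∀ k (ks : List (Fin n)) j ws → List.lookup ks j ≡ k →
      Balanced (r k ∷ map r ks ++ ws)
    balanced-repeatedHead k (.k ∷ ks) zero ws ≡.refl = det-swap (r k) (r k) (map r ks ++ ws)
    balanced-repeatedHead k (k′ ∷ ks) (suc j) ws eq =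
      balanced-swap (r k) (r k′) (map r ks ++ ws)
        (balanced-∷ (r k′) (r k ∷ map r ks ++ ws) (balanced-repeatedHead k ks j ws eq))

    balanced-repeated : ∀ (ks : List (Fin n)) {i j} → i Fin.< j →
      List.lookup ks i ≡ List.lookup ks j → ∀ ws → Balanced (map r ks ++ ws)
    balanced-repeated (k ∷ ks) {zero}  {suc j} i<j       eq ws =
      balanced-repeatedHead k ks j ws (≡.sym eq)
    balanced-repeated (k ∷ ks) {suc i} {suc j} (s≤s i<j) eq ws =
      balanced-∷ (r k) (map r ks ++ ws) (balanced-repeated ks i<j eq ws)

    -- Multilinear expansion row by row: `ks` records which `r k` was chosen for each row already
    -- expanded. In the end more than `n` rows are chosen among `n` vectors, and two coincide.
    balanced-rankDeficient : ∀ (l : ℕ → Fin n → Carrier) (ks : List (Fin n)) is →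
      n ℕ.< length ks ℕ.+ length is →
      Balanced (map r ks ++ map (λ i c → sum (λ k → l i k * r k c)) is)
    balanced-rankDeficient l ks [] n<
      with i , j , i<j , eq ← pigeonhole (≡.subst (n ℕ.<_) (ℕ.+-identityʳ _) n<) (List.lookup ks) =
      balanced-repeated ks i<j eq []
    balanced-rankDeficient l ks (i ∷ is) n< =
      balanced-combination (map r ks) (l i) r rows λ k →
        ≡.subst Balanced (snoc k) (balanced-rankDeficient l (ks ++ k ∷ []) is (bound k))
      where
      rows = map (λ i c → sum (λ k → l i k * r k c)) is

      snoc : ∀ k → map r (ks ++ k ∷ []) ++ rows ≡ map r ks ++ r k ∷ rows
      snoc k = ≡.trans (≡.cong (_++ rows) (map-++ r ks (k ∷ []))) (++-assoc (map r ks) _ rows)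

      bound : ∀ k → n ℕ.< length (ks ++ k ∷ []) ℕ.+ length is
      bound k = ≡.subst (n ℕ.<_) (≡.sym (≡.trans
        (≡.cong (ℕ._+ length is) (length-++ ks)) (ℕ.+-assoc (length ks) 1 (length is)))) n<

  sumPowers : Carrier → List ℕ → Carrier
  sumPowers x []       = 0#
  sumPowers x (e ∷ es) = x ^ e + sumPowers x es

  sumPowers-++ : ∀ x es fs → sumPowers x (es ++ fs) ≈ sumPowers x es + sumPowers x fs
  sumPowers-++ x []       fs = sym (+-identityˡ _)
  sumPowers-++ x (e ∷ es) fs = trans (+-congˡ (sumPowers-++ x es fs)) (sym (+-assoc _ _ _))

  sumPowers-shift : ∀ x a es → sumPowers x (map (a ℕ.+_) es) ≈ x ^ a * sumPowers x es
  sumPowers-shift x a []       = sym (zeroʳ _)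
  sumPowers-shift x a (e ∷ es) = trans
    (+-cong (^-homo-* x a e) (sumPowers-shift x a es)) (sym (distribˡ _ _ _))

  -- The rows come from a factorization and match powers of `base` only up to `_≈_`. Bundling them
  -- lets an `Expansion` fix its exponent lists before `base` is known.
  record HankelRows : Set (c ⊔ ℓ) where
    field
      base : Carrier
      row  : ℕ → Row
      row≈ : ∀ i c → row i c ≈ base ^ (4 ℕ.^ (i ℕ.+ c))

  open HankelRows

  Expansion : ℕ → (HankelRows → Signed) → Set _
  Expansion β f = ∃₂ λ es fs → All (ℕ._≤ β) es × All (ℕ._≤ β) fs ×
    ∀ H → f H ≋ (sumPowers (base H) es , sumPowers (base H) fs)

  ◃-sumPowers : ∀ H i c es fs →
    row H i c ◃ (sumPowers (base H) es , sumPowers (base H) fs) ≋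
    (sumPowers (base H) (map (4 ℕ.^ (i ℕ.+ c) ℕ.+_) es) , sumPowers (base H) (map (4 ℕ.^ (i ℕ.+ c) ℕ.+_) fs))
  ◃-sumPowers H i c es fs =
    trans (*-congʳ (row≈ H i c)) (sym (sumPowers-shift (base H) _ es)) ,
    trans (*-congʳ (row≈ H i c)) (sym (sumPowers-shift (base H) _ fs))

  ⊕-sumPowers : ∀ H es fs es′ fs′ →
    (sumPowers (base H) es , sumPowers (base H) fs) ⊕ (sumPowers (base H) es′ , sumPowers (base H) fs′) ≋
    (sumPowers (base H) (es ++ es′) , sumPowers (base H) (fs ++ fs′))
  ⊕-sumPowers H es fs es′ fs′ = sym (sumPowers-++ _ es es′) , sym (sumPowers-++ _ fs fs′)

  expansion-◃ : ∀ {β f j} i c → c ℕ.≤ j → Expansion β f →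
    Expansion (4 ℕ.^ (i ℕ.+ j) ℕ.+ β) (λ H → row H i c ◃ f H)
  expansion-◃ i c c≤j (es , fs , es≤ , fs≤ , f≋) =
    map (4 ℕ.^ (i ℕ.+ c) ℕ.+_) es , map (4 ℕ.^ (i ℕ.+ c) ℕ.+_) fs ,
    All.map⁺ (All.map (ℕ.+-mono-≤ 4^≤) es≤) , All.map⁺ (All.map (ℕ.+-mono-≤ 4^≤) fs≤) ,
    λ H → ≋-trans (◃-congˡ (f≋ H)) (◃-sumPowers H i c es fs)
    where 4^≤ = ℕ.^-monoʳ-≤ 4 (ℕ.+-monoʳ-≤ i c≤j)

  expansion-alternate : ∀ {p} {P : ℕ → Set p} {β} cs {f : HankelRows → ℕ → List ℕ → Signed} →
    All P cs → (∀ c cs′ → P c → All P cs′ → Expansion β (λ H → f H c cs′)) →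
    Expansion β (λ H → alternate cs (f H))
  expansion-alternate []       _          exp = [] , [] , [] , [] , λ _ → ≋-refl
  expansion-alternate (c ∷ cs) (Pc ∷ Pcs) exp
    with es , fs , es≤ , fs≤ , f≋ ← exp c cs Pc Pcs
       | es′ , fs′ , es′≤ , fs′≤ , f′≋ ← expansion-alternate cs Pcs
           (λ c′ cs′ Pc′ Pcs′ → exp c′ (c ∷ cs′) Pc′ (Pc ∷ Pcs′)) =
    es ++ fs′ , fs ++ es′ , All.++⁺ es≤ fs′≤ , All.++⁺ fs≤ es′≤ ,
    λ H → ≋-trans (⊕-cong (f≋ H) (neg-cong (f′≋ H))) (⊕-sumPowers H es fs fs′ es′)

  expansion-det : ∀ is {j} cs → All (ℕ._≤ j) cs →
    Expansion (degreeBound is j) (λ H → det (map (row H) is) cs)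
  expansion-det []       cs cs≤ =
    0 ∷ [] , [] , z≤n ∷ [] , [] , λ _ → sym (+-identityʳ 1#) , refl
  expansion-det (i ∷ is) cs cs≤ = expansion-alternate cs cs≤
    (λ c cs′ c≤ cs′≤ → expansion-◃ i c c≤ (expansion-det is cs′ cs′≤))

  MonicExpansion : (HankelRows → Signed) → Set _
  MonicExpansion f = ∃ λ d → ∃₂ λ es fs → All (ℕ._< d) es × All (ℕ._< d) fs ×
    ∀ H → f H ≋ (sumPowers (base H) (d ∷ es) , sumPowers (base H) fs)

  -- Up to sign, these are the terms of the minor of order `m + 1` whose top row uses a column other
  -- than `m`; column `m` then remains for the lower rows.
  expansion-offDiagonal : ∀ m → ∃₂ λ es fs → All (ℕ._< 4 ℕ.^ (m ℕ.+ m)) es × All (ℕ._< 4 ℕ.^ (m ℕ.+ m)) fs ×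
    ∀ H → alternate (downFrom m) (λ c cs → row H m c ◃ det (map (row H) (downFrom m)) (m ∷ cs)) ≋
          (sumPowers (base H) es , sumPowers (base H) fs)
  expansion-offDiagonal zero    = [] , [] , [] , [] , λ _ → ≋-refl
  expansion-offDiagonal (suc j)
    with es , fs , es≤ , fs≤ , f≋ ← expansion-alternate (downFrom (suc j)) (downFrom-≤ j)
           (λ c cs c≤ cs≤ → expansion-◃ (suc j) c c≤ (expansion-det (downFrom (suc j))
             (suc j ∷ cs) (ℕ.≤-refl ∷ All.map ℕ.m≤n⇒m≤1+n cs≤))) =
    es , fs , All.map (λ k≤ → ℕ.≤-<-trans k≤ (offDiagonal< j)) es≤ ,
    All.map (λ k≤ → ℕ.≤-<-trans k≤ (offDiagonal< j)) fs≤ , f≋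

  -- Column `m` heads the list, so the diagonal entry times the previous minor has sign plus and
  -- contributes the leading exponent `e + d`. The lower terms of that minor stay below `e + d`, and
  -- the off-diagonal terms stay below `e`.
  monicExpansion-det : ∀ m → MonicExpansion (λ H → det (map (row H) (downFrom m)) (downFrom m))
  monicExpansion-det zero    = 0 , [] , [] , [] , [] , λ _ → sym (+-identityʳ 1#) , refl
  monicExpansion-det (suc m)
    with d , es , fs , es< , fs< , f≋ ← monicExpansion-det m
       | es′ , fs′ , es′< , fs′< , f′≋ ← expansion-offDiagonal m =
    e ℕ.+ d , map (e ℕ.+_) es ++ fs′ , map (e ℕ.+_) fs ++ es′ ,
    All.++⁺ (All.map⁺ (All.map (ℕ.+-monoʳ-< e) es<)) (All.map small fs′<) ,
    All.++⁺ (All.map⁺ (All.map (ℕ.+-monoʳ-< e) fs<)) (All.map small es′<) ,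
    λ H → ≋-trans
      (⊕-cong (≋-trans (◃-congˡ (f≋ H)) (◃-sumPowers H m m (d ∷ es) fs)) (neg-cong (f′≋ H)))
      (⊕-sumPowers H (e ℕ.+ d ∷ map (e ℕ.+_) es) (map (e ℕ.+_) fs) fs′ es′)
    where
    e = 4 ℕ.^ (m ℕ.+ m)

    small : ∀ {d k} → k ℕ.< e → k ℕ.< e ℕ.+ d
    small {d} k<e = ℕ.<-≤-trans k<e (ℕ.m≤m+n e d)

  -- The minor on rows and columns `0` to `n` is balanced, and comparing the two components of its
  -- expansion gives the equation. The exponents are fixed before `x`, so one equation serves every
  -- `x` of rank `n`.
  hankelRank⇒monic : ∀ n → ∃ λ d → ∃₂ λ es fs → All (ℕ._< d) es × All (ℕ._< d) fs ×
    ∀ x → HankelRank n x → x ^ d + sumPowers x es ≈ sumPowers x fs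
  hankelRank⇒monic n with d , es , fs , es< , fs< , f≋ ← monicExpansion-det (suc n) =
    d , es , fs , es< , fs< , λ x (l , r , lr) →
      let H = record { base = x ; row = λ i c → sum (λ k → l i k * r c k) ; row≈ = lr }
          bal = balanced-rankDeficient (λ k c → r c k) l [] (downFrom (suc n))
            (ℕ.≤-reflexive (≡.sym (length-downFrom (suc n)))) (downFrom (suc n))
      in trans (sym (proj₁ (f≋ H))) (trans (proj₁ bal) (proj₂ (f≋ H)))

-- The natural preorder of a commutative semiring.

module NaturalOrder {c ℓ} (S : CommutativeSemiring c ℓ) where

  open CommutativeSemiring S hiding (zero)
  open import Algebra.Properties.CommutativeSemiring.Exp S
  open import Algebra.Properties.CommutativeSemigroup.Divisibility +-commutativeSemigroup public
    using () renaming (_∣_ to _≲_; ∙-cong-∣ to +-mono-≲; x∣ʳyx to x≲y+x; x∣xy to x≲x+y)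
  open import Algebra.Properties.Monoid.Divisibility +-monoid public
    using () renaming (∣ʳ-refl to ≲-refl; ∣ʳ-reflexive to ≲-reflexive; ∣ʳ-trans to ≲-trans;
                       ∣ʳ-preorder to ≲-preorder; ε∣ʳ_ to 0≲)
  open import Algebra.Definitions.RawMagma (CommutativeSemigroup.rawMagma +-commutativeSemigroup)
    public using (_,_)
  open import Relation.Binary.Reasoning.Preorder ≲-preorder

  *-monoˡ-≲ : ∀ z {x y} → x ≲ y → z * x ≲ z * y
  *-monoˡ-≲ z (d , d+x≈y) = z * d , trans (sym (distribˡ z d _)) (*-congˡ d+x≈y)

  *-mono-≲ : ∀ {x y u v} → x ≲ y → u ≲ v → x * u ≲ y * v
  *-mono-≲ {x} {y} {u} {v} x≲y u≲v = begin
    x * u  ≲⟨ *-monoˡ-≲ x u≲v ⟩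
    x * v  ≈⟨ *-comm x v ⟩
    v * x  ≲⟨ *-monoˡ-≲ v x≲y ⟩
    v * y  ≈⟨ *-comm v y ⟩
    y * v  ∎

  *-monoʳ-≲ : ∀ z {x y} → x ≲ y → x * z ≲ y * z
  *-monoʳ-≲ z x≲y = *-mono-≲ x≲y ≲-refl

  ^-mono-≲ : ∀ n {x y} → x ≲ y → x ^ n ≲ y ^ n
  ^-mono-≲ zero    x≲y = ≲-refl
  ^-mono-≲ (suc n) x≲y = *-mono-≲ x≲y (^-mono-≲ n x≲y)

  absorb : ∀ {u v} → u + u ≈ u → u ≲ v → v + u ≈ v
  absorb {u} {v} u+u≈u (d , d+u≈v) = begin-equality
    v + u        ≈⟨ +-congʳ d+u≈v ⟨
    d + u + u    ≈⟨ +-assoc d u u ⟩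
    d + (u + u)  ≈⟨ +-congˡ u+u≈u ⟩
    d + u        ≈⟨ d+u≈v ⟩
    v            ∎

  -- Two additive idempotents that bound each other both equal their sum.
  antisym : ∀ {u v} → u + u ≈ u → v + v ≈ v → u ≲ v → v ≲ u → u ≈ v
  antisym {u} {v} uu vv u≲v v≲u = begin-equality
    u      ≈⟨ absorb vv v≲u ⟨
    u + v  ≈⟨ +-comm u v ⟩
    v + u  ≈⟨ absorb uu u≲v ⟩
    v      ∎

  join : ∀ {u v w} → v + v ≈ v → u ≲ w → v ≲ w → u + v ≲ w
  join {u} {v} {w} vv u≲w v≲w = begin
    u + v  ≲⟨ +-mono-≲ u≲w ≲-refl ⟩
    w + v  ≈⟨ absorb vv v≲w ⟩
    w      ∎

-- Binomial estimates with saturated multiplicities.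

module Saturation {c ℓ} (S : CommutativeSemiring c ℓ) where

  open CommutativeSemiring S hiding (zero)
  open import Algebra.Properties.CommutativeSemiring.Exp S
  open import Algebra.Properties.Semiring.Mult semiring
    using (×-congʳ; ×-assoc-*; ×-comm-*) renaming (_×_ to _·_)
  open import Algebra.Solver.Ring.NaturalCoefficients.Default S using (solve; _:=_; _:+_; _:*_; con)
  open NaturalOrder S
  open import Relation.Binary.Reasoning.Preorder ≲-preorder

  -- ι is a positive multiple of 1 that is additively idempotent, so that a summand ι * u counts
  -- as u with infinite multiplicity.
  record Saturating : Set (c ⊔ ℓ) where
    field
      ι     : Carrier
      q     : ℕ
      ι≈    : ι ≈ suc q · 1#
      ι+ι≈ι : ι + ι ≈ ι

  module SaturatingLaws (σ : Saturating) where

    open Saturating σ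

    ι*-idem : ∀ u → ι * u + ι * u ≈ ι * u
    ι*-idem u = trans (sym (distribʳ u ι ι)) (*-congʳ ι+ι≈ι)

    multiple≈ι* : ∀ u → suc q · u ≈ ι * u
    multiple≈ι* u = begin-equality
      suc q · u           ≈⟨ ×-congʳ (suc q) (*-identityˡ u) ⟨
      suc q · (1# * u)    ≈⟨ ×-assoc-* (suc q) 1# u ⟨
      suc q · 1# * u      ≈⟨ *-congʳ ι≈ ⟨
      ι * u               ∎

    ≲ι* : ∀ u → u ≲ ι * u
    ≲ι* u = ≲-trans (x≲x+y u (q · u)) (≲-reflexive (multiple≈ι* u))

    ι*-join : ∀ {u v w} → ι * u ≲ w → ι * v ≲ w → ι * (u + v) ≲ w
    ι*-join {u} {v} {w} u≲w v≲w = begin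
      ι * (u + v)    ≈⟨ distribˡ ι u v ⟩
      ι * u + ι * v  ≲⟨ join (ι*-idem v) u≲w v≲w ⟩
      w              ∎

    ι*-mono : ∀ {u v} → u ≲ v → ι * u ≲ ι * v
    ι*-mono = *-monoˡ-≲ ι

    ι*-joinʳ : ∀ {u v w} → u ≲ ι * w → v ≲ ι * w → u + v ≲ ι * w
    ι*-joinʳ {u} {v} {w} p r = ≲-trans (+-mono-≲ p r) (≲-reflexive (ι*-idem w))

    module _ (a b : Carrier) where

      private
        s = a + b
        a≲s = x≲x+y a b
        b≲s : b ≲ s
        b≲s = x≲y+x b a

      -- A word of length `i + j` in `a` and `b` has at least `i` letters `a` or at least `j`
      -- letters `b`; `ι` makes its multiplicity irrelevant.
      ι*binomial : ∀ i j → ι * s ^ (i ℕ.+ j) ≲ ι * (a ^ i * s ^ j + b ^ j * s ^ i)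
      ι*binomial zero j = ι*-mono (≲-trans (≲-reflexive (sym (*-identityˡ _))) (x≲x+y _ _))
      ι*binomial (suc i) zero = ι*-mono (≲-trans
        (≲-reflexive (trans (^-congʳ s (ℕ.+-identityʳ (suc i))) (sym (*-identityˡ _)))) (x≲y+x _ _))
      ι*binomial (suc i) (suc j) = begin
        ι * (s * s ^ (i ℕ.+ suc j))
          ≈⟨ solve 4 (λ ι a b p → ι :* ((a :+ b) :* p) := a :* (ι :* p) :+ b :* (ι :* p)) refl ι a b _ ⟩
        a * (ι * s ^ (i ℕ.+ suc j)) + b * (ι * s ^ (i ℕ.+ suc j))
          ≲⟨ +-mono-≲ (*-monoˡ-≲ a (ι*binomial i (suc j)))
               (*-monoˡ-≲ b (≲-trans (≲-reflexive (*-congˡ (^-congʳ s (ℕ.+-suc i j)))) (ι*binomial (suc i) j))) ⟩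
        a * (ι * (a ^ i * (s * s ^ j) + b * b ^ j * s ^ i)) + b * (ι * (a * a ^ i * s ^ j + b ^ j * (s * s ^ i)))
          ≈⟨ solve 8 (λ ι a b s aⁱ bʲ sⁱ sʲ →
               a :* (ι :* (aⁱ :* (s :* sʲ) :+ b :* bʲ :* sⁱ)) :+ b :* (ι :* (a :* aⁱ :* sʲ :+ bʲ :* (s :* sⁱ)))
               := ι :* (a :* aⁱ :* (s :* sʲ) :+ b :* bʲ :* (a :* sⁱ)) :+ ι :* (a :* aⁱ :* (b :* sʲ) :+ b :* bʲ :* (s :* sⁱ)))
               refl ι a b s (a ^ i) (b ^ j) (s ^ i) (s ^ j) ⟩
        ι * (a * a ^ i * (s * s ^ j) + b * b ^ j * (a * s ^ i)) + ι * (a * a ^ i * (b * s ^ j) + b * b ^ j * (s * s ^ i))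
          ≲⟨ +-mono-≲ (ι*-mono (+-mono-≲ ≲-refl (*-monoˡ-≲ _ (*-monoʳ-≲ _ a≲s))))
                      (ι*-mono (+-mono-≲ (*-monoˡ-≲ _ (*-monoʳ-≲ _ b≲s)) ≲-refl)) ⟩
        ι * (a ^ suc i * s ^ suc j + b ^ suc j * s ^ suc i) + ι * (a ^ suc i * s ^ suc j + b ^ suc j * s ^ suc i)
          ≈⟨ ι*-idem _ ⟩
        ι * (a ^ suc i * s ^ suc j + b ^ suc j * s ^ suc i)  ∎

      -- A word that is not a pure power contains both letters, so one `a` and one `b` can be split
      -- off.
      binomial≲pure+mixed : ∀ k →
        s ^ (2 ℕ.+ k) ≲ a ^ (2 ℕ.+ k) + b ^ (2 ℕ.+ k) + ι * (a * b * s ^ k)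
      binomial≲pure+mixed zero = begin
        s * (s * 1#)
          ≈⟨ solve 2 (λ a b → (a :+ b) :* ((a :+ b) :* con 1) :=
               (a :* (a :* con 1) :+ b :* (b :* con 1)) :+ (a :* b :* con 1 :+ a :* b :* con 1)) refl a b ⟩
        a ^ 2 + b ^ 2 + (a * b * 1# + a * b * 1#)
          ≲⟨ +-mono-≲ ≲-refl (ι*-joinʳ (≲ι* _) (≲ι* _)) ⟩
        a ^ 2 + b ^ 2 + ι * (a * b * 1#)  ∎
      binomial≲pure+mixed (suc k) = begin
        s * s ^ (2 ℕ.+ k)
          ≲⟨ *-monoˡ-≲ s (binomial≲pure+mixed k) ⟩
        s * (a * (a * a ^ k) + b * (b * b ^ k) + ι * (a * b * s ^ k))
          ≈⟨ solve 6 (λ a b ι aᵏ bᵏ sᵏ →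
               (a :+ b) :* (a :* (a :* aᵏ) :+ b :* (b :* bᵏ) :+ ι :* (a :* b :* sᵏ)) :=
               (a :* (a :* (a :* aᵏ)) :+ b :* (b :* (b :* bᵏ))) :+
                 (a :* b :* (a :* aᵏ) :+ a :* b :* (b :* bᵏ) :+ ι :* (a :* b :* ((a :+ b) :* sᵏ))))
               refl a b ι (a ^ k) (b ^ k) (s ^ k) ⟩
        a ^ (3 ℕ.+ k) + b ^ (3 ℕ.+ k) + (a * b * a ^ suc k + a * b * b ^ suc k + ι * (a * b * s ^ suc k))
          ≲⟨ +-mono-≲ ≲-refl (ι*-joinʳ (ι*-joinʳ (mixed a≲s) (mixed b≲s)) ≲-refl) ⟩
        a ^ (3 ℕ.+ k) + b ^ (3 ℕ.+ k) + ι * (a * b * s ^ suc k)  ∎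
        where
        mixed : ∀ {e} → e ≲ s → a * b * e ^ suc k ≲ ι * (a * b * s ^ suc k)
        mixed e≲s = ≲-trans (*-monoˡ-≲ (a * b) (^-mono-≲ (suc k) e≲s)) (≲ι* _)

      leadingTerms≲binomial : ∀ k → a ^ suc k + suc k · (a ^ k * b) ≲ s ^ suc k
      leadingTerms≲binomial zero = ≲-reflexive
        (solve 2 (λ a b → a :* con 1 :+ (con 1 :* b :+ con 0) := (a :+ b) :* con 1) refl a b)
      leadingTerms≲binomial (suc k) = begin
        a * (a * a ^ k) + (a * a ^ k * b + suc k · (a * a ^ k * b))
          ≈⟨ +-congˡ (+-congˡ (trans (×-congʳ (suc k) (*-assoc a _ b)) (sym (×-comm-* (suc k) a _)))) ⟩
        a * (a * a ^ k) + (a * a ^ k * b + a * (suc k · (a ^ k * b)))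
          ≲⟨ x≲x+y _ (b * (suc k · (a ^ k * b))) ⟩
        a * (a * a ^ k) + (a * a ^ k * b + a * (suc k · (a ^ k * b))) + b * (suc k · (a ^ k * b))
          ≈⟨ solve 4 (λ a b aᵏ m → a :* (a :* aᵏ) :+ (a :* aᵏ :* b :+ a :* m) :+ b :* m :=
               (a :+ b) :* (a :* aᵏ :+ m)) refl a b (a ^ k) (suc k · (a ^ k * b)) ⟩
        s * (a * a ^ k + suc k · (a ^ k * b))
          ≲⟨ *-monoˡ-≲ s (leadingTerms≲binomial k) ⟩
        s * s ^ suc k  ∎

      powers≲binomial : ∀ k → a ^ suc k + b ^ suc k ≲ s ^ suc k
      powers≲binomial zero = ≲-reflexive
        (solve 2 (λ a b → a :* con 1 :+ b :* con 1 := (a :+ b) :* con 1) refl a b)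
      powers≲binomial (suc k) = begin
        a * a ^ suc k + b * b ^ suc k
          ≲⟨ x≲x+y _ (a * b ^ suc k + b * a ^ suc k) ⟩
        a * a ^ suc k + b * b ^ suc k + (a * b ^ suc k + b * a ^ suc k)
          ≈⟨ solve 4 (λ a b p r → a :* p :+ b :* r :+ (a :* r :+ b :* p) := (a :+ b) :* (p :+ r))
               refl a b (a ^ suc k) (b ^ suc k) ⟩
        s * (a ^ suc k + b ^ suc k)  ≲⟨ *-monoˡ-≲ s (powers≲binomial k) ⟩
        s * s ^ suc k                ∎

      -- The coefficient of `a ^ q * b` in the power `suc q` is `suc q`, precisely the multiplicity
      -- that amounts to `ι`.
      saturated : ι * (a ^ q * b) ≲ s ^ suc q
      saturated = begin
        ι * (a ^ q * b)                      ≈⟨ multiple≈ι* _ ⟨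
        suc q · (a ^ q * b)                  ≲⟨ x≲y+x _ _ ⟩
        a ^ suc q + suc q · (a ^ q * b)      ≲⟨ leadingTerms≲binomial q ⟩
        s ^ suc q                            ∎

      binomial≲power+mixed : ∀ k → s ^ suc k ≲ a ^ suc k + ι * (b * s ^ k)
      binomial≲power+mixed zero = begin
        s * 1#                ≈⟨ distribʳ 1# a b ⟩
        a * 1# + b * 1#       ≲⟨ +-mono-≲ ≲-refl (≲ι* _) ⟩
        a * 1# + ι * (b * 1#) ∎
      binomial≲power+mixed (suc k) = begin
        s * s ^ suc k  ≈⟨ distribʳ _ a b ⟩
        a * s ^ suc k + b * s ^ suc k
          ≲⟨ +-mono-≲ (*-monoˡ-≲ a (binomial≲power+mixed k)) ≲-refl ⟩
        a * (a ^ suc k + ι * (b * s ^ k)) + b * s ^ suc k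
          ≈⟨ solve 6 (λ a b ι p sᵏ r → a :* (p :+ ι :* (b :* sᵏ)) :+ r := a :* p :+ (ι :* (b :* (a :* sᵏ)) :+ r))
               refl a b ι (a ^ suc k) (s ^ k) (b * s ^ suc k) ⟩
        a ^ suc (suc k) + (ι * (b * (a * s ^ k)) + b * s ^ suc k)
          ≲⟨ +-mono-≲ ≲-refl (ι*-joinʳ (ι*-mono (*-monoˡ-≲ b (*-monoʳ-≲ _ a≲s))) (≲ι* _)) ⟩
        a ^ suc (suc k) + ι * (b * s ^ suc k)  ∎

    -- By `ι*binomial`, a factor `a ^ suc q` or `b ^ suc q` can be split off the power. Together
    -- with `a * b` it contains `a ^ q * b` or `b ^ q * a`, to which `saturated` applies. So large
    -- powers absorb their mixed terms.
    mixed≲binomial : ∀ a b → ι * (a * b * (a + b) ^ (suc q ℕ.+ suc q)) ≲ (a + b) ^ (2 ℕ.+ (suc q ℕ.+ suc q))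
    mixed≲binomial a b = begin
      ι * (a * b * s ^ (suc q ℕ.+ suc q))
        ≈⟨ solve 4 (λ ι a b p → ι :* (a :* b :* p) := a :* b :* (ι :* p)) refl ι a b _ ⟩
      a * b * (ι * s ^ (suc q ℕ.+ suc q))
        ≲⟨ *-monoˡ-≲ (a * b) (ι*binomial a b (suc q) (suc q)) ⟩
      a * b * (ι * (a * a ^ q * s ^ suc q + b * b ^ q * s ^ suc q))
        ≈⟨ solve 6 (λ ι a b aq bq p → a :* b :* (ι :* (a :* aq :* p :+ b :* bq :* p)) :=
             ι :* (aq :* b :* (a :* (a :* p)) :+ bq :* a :* (b :* (b :* p)))) refl ι a b (a ^ q) (b ^ q) (s ^ suc q) ⟩
      ι * (a ^ q * b * (a * (a * s ^ suc q)) + b ^ q * a * (b * (b * s ^ suc q)))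
        ≲⟨ ι*-join (part (x≲x+y a b) (saturated a b))
             (part (x≲y+x b a) (≲-trans (saturated b a) (≲-reflexive (^-congˡ (suc q) (+-comm b a))))) ⟩
      s * (s * (s ^ suc q * s ^ suc q))
        ≈⟨ *-congˡ (*-congˡ (^-homo-* s (suc q) (suc q))) ⟨
      s ^ (2 ℕ.+ (suc q ℕ.+ suc q))  ∎
      where
      s = a + b
      part : ∀ {e f} → e ≲ s → ι * f ≲ s ^ suc q → ι * (f * (e * (e * s ^ suc q))) ≲ s * (s * (s ^ suc q * s ^ suc q))
      part {e} {f} e≲s f≲ = begin
        ι * (f * (e * (e * s ^ suc q)))      ≈⟨ *-assoc ι f _ ⟨
        ι * f * (e * (e * s ^ suc q))        ≲⟨ *-mono-≲ f≲ (*-mono-≲ e≲s (*-monoʳ-≲ _ e≲s)) ⟩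
        s ^ suc q * (s * (s * s ^ suc q))
          ≈⟨ solve 2 (λ p s → p :* (s :* (s :* p)) := s :* (s :* (p :* p))) refl (s ^ suc q) s ⟩
        s * (s * (s ^ suc q * s ^ suc q))    ∎

-- Passing inequalities from the summands to their sum.

module Shift {c ℓ} (S : CommutativeSemiring c ℓ) where

  open CommutativeSemiring S hiding (zero)
  open import Algebra.Properties.CommutativeSemiring.Exp S
  open import Algebra.Properties.Semiring.Sum semiring
  open import Algebra.Solver.Ring.NaturalCoefficients.Default S using (solve; _:=_; _:+_; _:*_; con)
  open NaturalOrder S
  open Saturation S
  open import Relation.Binary.Reasoning.Preorder ≲-preorder

  summand≲sum : ∀ {n} (f : Fin n → Carrier) k → f k ≲ sum f
  summand≲sum f zero    = x≲x+y _ _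
  summand≲sum f (suc k) = ≲-trans (summand≲sum (λ k → f (suc k)) k) (x≲y+x _ _)

  -- An induction principle for finite sums bounded by `α`: all partial sums stay below `α`, so
  -- closure under addition may assume this bound.
  record SumClosedBelow {p} (α : Carrier) (P : Carrier → Set p) : Set (c ⊔ ℓ ⊔ p) where
    field
      P-≈  : ∀ {u v} → u ≈ v → P u → P v
      P-0   : P 0#
      P-+   : ∀ {a b} → a + b ≲ α → P a → P b → P (a + b)

    P-sum : ∀ {n} {f : Fin n → Carrier} → sum f ≲ α → (∀ k → P (f k)) → P (sum f)
    P-sum {zero}  f≲ Pf = P-0
    P-sum {suc n} {f} f≲ Pf = P-+ f≲ (Pf zero)
      (P-sum (≲-trans (x≲y+x (sum (λ k → f (suc k))) (f zero)) f≲) (λ k → Pf (suc k)))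

    P-sumVec : ∀ {n} k {f : Vec (Fin n) k → Carrier} → sumVec semiring k f ≲ α →
      (∀ ps → P (f ps)) → P (sumVec semiring k f)
    P-sumVec zero    f≲ Pf = Pf []
    P-sumVec {n} (suc k) {f} f≲ Pf = P-sum f≲ λ p →
      P-sumVec k (≲-trans (summand≲sum (λ p → sumVec semiring k (λ ps → f (p ∷ ps))) p) f≲) (λ ps → Pf (p ∷ ps))

  module _ (σ : Saturating) (α : Carrier) where

    open Saturating σ
    open SaturatingLaws σ

    SaturatedShift : Carrier → Carrier → Carrier → Set (c ⊔ ℓ)
    SaturatedShift g g′ w = ∃ λ s → ι * (w ^ s * g) ≲ ι * (α ^ s * g′)

    -- Every term of `(a + b) ^ (s + t)` contains `a ^ s` or `b ^ t`, so one of the two hypotheses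
    -- applies; the remaining factor is bounded by a power of `α`.
    saturatedShift-sumClosed : ∀ g g′ → SumClosedBelow α (SaturatedShift g g′)
    saturatedShift-sumClosed g g′ = record
      { P-≈  = λ u≈v (s , w≲) → s , ≲-trans (≲-reflexive (*-congˡ (*-congʳ (^-congˡ s (sym u≈v))))) w≲
      -- Exponent 1, because `0# ^ 0` is `1#`.
      ; P-0  = 1 , ≲-trans (≲-reflexive (solve 2 (λ ι g → ι :* (con 0 :* con 1 :* g) := con 0) refl ι g)) (0≲ _)
      ; P-+  = λ {a} {b} a+b≲α (s , a≲) (t , b≲) → s ℕ.+ t , (begin
          ι * ((a + b) ^ (s ℕ.+ t) * g)
            ≈⟨ *-assoc ι _ g ⟨
          ι * (a + b) ^ (s ℕ.+ t) * g
            ≲⟨ *-monoʳ-≲ g (ι*binomial a b s t) ⟩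
          ι * (a ^ s * (a + b) ^ t + b ^ t * (a + b) ^ s) * g
            ≈⟨ solve 6 (λ ι p r p′ r′ g → ι :* (p :* r :+ p′ :* r′) :* g :=
                 ι :* (p :* g) :* r :+ ι :* (p′ :* g) :* r′) refl ι _ _ _ _ g ⟩
          ι * (a ^ s * g) * (a + b) ^ t + ι * (b ^ t * g) * (a + b) ^ s
            ≲⟨ +-mono-≲ (*-mono-≲ a≲ (^-mono-≲ t a+b≲α)) (*-mono-≲ b≲ (^-mono-≲ s a+b≲α)) ⟩
          ι * (α ^ s * g′) * α ^ t + ι * (α ^ t * g′) * α ^ s
            ≈⟨ solve 4 (λ ι p g r → ι :* (p :* g) :* r :+ ι :* (r :* g) :* p :=
                 ι :* (p :* r :* g) :+ ι :* (p :* r :* g)) refl ι (α ^ s) g′ (α ^ t) ⟩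
          ι * (α ^ s * α ^ t * g′) + ι * (α ^ s * α ^ t * g′)
            ≈⟨ ι*-idem _ ⟩
          ι * (α ^ s * α ^ t * g′)
            ≈⟨ *-congˡ (*-congʳ (^-homo-* α s t)) ⟨
          ι * (α ^ (s ℕ.+ t) * g′)  ∎)
      }

    module _ {G G′ : Carrier} (ιG≈ιG′ : ι * G ≈ ι * G′) where

      -- The error term ι * (z * G′) is absorbed by both sides once w is α.
      ShiftUpToSaturated : Carrier → Set (c ⊔ ℓ)
      ShiftUpToSaturated w = ∃₂ λ k b → ∃ λ z →
        w ^ k * α ^ b * G ≲ w ^ k * α ^ b * G′ + ι * (z * G′) × ι * z ≲ α ^ (k ℕ.+ b)

      private
        ι*[z*G]≈ : ∀ z → ι * (z * G) ≈ ι * (z * G′)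
        ι*[z*G]≈ z = begin-equality
          ι * (z * G)   ≈⟨ solve 3 (λ ι z g → ι :* (z :* g) := z :* (ι :* g)) refl ι z G ⟩
          z * (ι * G)   ≈⟨ *-congˡ ιG≈ιG′ ⟩
          z * (ι * G′)  ≈⟨ solve 3 (λ ι z g → z :* (ι :* g) := ι :* (z :* g)) refl ι z G′ ⟩
          ι * (z * G′)  ∎

      -- With `α` written as `w + v`, all terms of `α ^ suc s` except `w ^ suc s` contain `v`. The
      -- additional factor `w ^ q` makes them multiples of `w ^ q * v`, which `saturated` bounds by
      -- `α ^ suc q`; hence the witness `k = q`.
      shiftUpToSaturated-single : ∀ {w v} s → w + v ≈ α →
        w ^ suc s * G ≲ α ^ suc s * G′ → ShiftUpToSaturated w
      shiftUpToSaturated-single {w} {v} s w+v≈α w≲ = q , suc s , w ^ q * v * α ^ s , (begin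
        w ^ q * α ^ suc s * G
          ≈⟨ *-congʳ (*-congˡ (^-congˡ (suc s) w+v≈α)) ⟨
        w ^ q * (w + v) ^ suc s * G
          ≲⟨ *-monoʳ-≲ G (*-monoˡ-≲ (w ^ q) (binomial≲power+mixed w v s)) ⟩
        w ^ q * (w ^ suc s + ι * (v * (w + v) ^ s)) * G
          ≈⟨ *-congʳ (*-congˡ (+-congˡ (*-congˡ (*-congˡ (^-congˡ s w+v≈α))))) ⟩
        w ^ q * (w ^ suc s + ι * (v * α ^ s)) * G
          ≈⟨ solve 6 (λ p r ι v a g → p :* (r :+ ι :* (v :* a)) :* g := p :* (r :* g) :+ ι :* (p :* v :* a :* g))
               refl (w ^ q) (w ^ suc s) ι v (α ^ s) G ⟩
        w ^ q * (w ^ suc s * G) + ι * (w ^ q * v * α ^ s * G)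
          ≲⟨ +-mono-≲ (*-monoˡ-≲ (w ^ q) w≲) (≲-reflexive (ι*[z*G]≈ _)) ⟩
        w ^ q * (α ^ suc s * G′) + ι * (w ^ q * v * α ^ s * G′)
          ≈⟨ +-congʳ (*-assoc (w ^ q) (α ^ suc s) G′) ⟨
        w ^ q * α ^ suc s * G′ + ι * (w ^ q * v * α ^ s * G′)  ∎) , (begin
        ι * (w ^ q * v * α ^ s)  ≈⟨ *-assoc ι _ _ ⟨
        ι * (w ^ q * v) * α ^ s  ≲⟨ *-monoʳ-≲ _ (saturated w v) ⟩
        (w + v) ^ suc q * α ^ s  ≈⟨ *-congʳ (^-congˡ (suc q) w+v≈α) ⟩
        α ^ suc q * α ^ s        ≈⟨ ^-homo-* α (suc q) s ⟨
        α ^ (suc q ℕ.+ s)        ≈⟨ ^-congʳ α (ℕ.+-suc q s) ⟨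
        α ^ (q ℕ.+ suc s)        ∎)

      private
        scale : ∀ {w} k b {z} j t → w ≲ α →
          w ^ k * α ^ b * G ≲ w ^ k * α ^ b * G′ + ι * (z * G′) → ι * z ≲ α ^ (k ℕ.+ b) →
          w ^ (k ℕ.+ j) * α ^ (b ℕ.+ t) * G ≲
            w ^ (k ℕ.+ j) * α ^ (b ℕ.+ t) * G′ + ι * (z * (w ^ j * α ^ t) * G′) ×
          ι * (z * (w ^ j * α ^ t)) ≲ α ^ ((k ℕ.+ j) ℕ.+ (b ℕ.+ t))
        scale {w} k b {z} j t w≲α w≲ z≲ = (begin
          w ^ (k ℕ.+ j) * α ^ (b ℕ.+ t) * G
            ≈⟨ *-congʳ (*-cong (^-homo-* w k j) (^-homo-* α b t)) ⟩
          w ^ k * w ^ j * (α ^ b * α ^ t) * G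
            ≈⟨ solve 5 (λ p r m n g → p :* r :* (m :* n) :* g := p :* m :* g :* (r :* n)) refl _ _ _ _ G ⟩
          w ^ k * α ^ b * G * (w ^ j * α ^ t)
            ≲⟨ *-monoʳ-≲ _ w≲ ⟩
          (w ^ k * α ^ b * G′ + ι * (z * G′)) * (w ^ j * α ^ t)
            ≈⟨ solve 7 (λ p r m n g ι z → (p :* m :* g :+ ι :* (z :* g)) :* (r :* n) :=
                 p :* r :* (m :* n) :* g :+ ι :* (z :* (r :* n) :* g)) refl (w ^ k) (w ^ j) (α ^ b) (α ^ t) G′ ι z ⟩
          w ^ k * w ^ j * (α ^ b * α ^ t) * G′ + ι * (z * (w ^ j * α ^ t) * G′)
            ≈⟨ +-congʳ (*-congʳ (*-cong (^-homo-* w k j) (^-homo-* α b t))) ⟨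
          w ^ (k ℕ.+ j) * α ^ (b ℕ.+ t) * G′ + ι * (z * (w ^ j * α ^ t) * G′)  ∎) , (begin
          ι * (z * (w ^ j * α ^ t))      ≈⟨ *-assoc ι z _ ⟨
          ι * z * (w ^ j * α ^ t)        ≲⟨ *-mono-≲ z≲ (*-monoʳ-≲ _ (^-mono-≲ j w≲α)) ⟩
          α ^ (k ℕ.+ b) * (α ^ j * α ^ t)
            ≈⟨ trans (^-homo-* α (k ℕ.+ b) (j ℕ.+ t)) (*-congˡ (^-homo-* α j t)) ⟨
          α ^ ((k ℕ.+ b) ℕ.+ (j ℕ.+ t))  ≈⟨ ^-congʳ α (lemma k b j t) ⟩
          α ^ ((k ℕ.+ j) ℕ.+ (b ℕ.+ t))  ∎)
          where
          lemma : ∀ k b j t → (k ℕ.+ b) ℕ.+ (j ℕ.+ t) ≡ (k ℕ.+ j) ℕ.+ (b ℕ.+ t)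
          lemma = solve-∀

      -- The pure powers of `a` and `b` are treated by the hypotheses, scaled to the common
      -- exponents `K` and `B`; the mixed terms join the error as `y₃`.
      shiftUpToSaturated-+ : ∀ {a b} → a + b ≲ α →
        ShiftUpToSaturated a → ShiftUpToSaturated b → ShiftUpToSaturated (a + b)
      shiftUpToSaturated-+ {a} {b} s≲α (k₁ , b₁ , z₁ , a≲ , z₁≲) (k₂ , b₂ , z₂ , b≲ , z₂≲) =
        K , B , y₁ + y₂ + y₃ , (begin
          s ^ K * α ^ B * G
            ≲⟨ *-monoʳ-≲ G (*-monoʳ-≲ (α ^ B) (binomial≲pure+mixed a b r)) ⟩
          (a ^ K + b ^ K + ι * (a * b * s ^ r)) * α ^ B * G
            ≈⟨ solve 6 (λ p q ι m n g → (p :+ q :+ ι :* m) :* n :* g :=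
                 p :* n :* g :+ q :* n :* g :+ ι :* (m :* n :* g)) refl (a ^ K) (b ^ K) ι (a * b * s ^ r) (α ^ B) G ⟩
          a ^ K * α ^ B * G + b ^ K * α ^ B * G + ι * (y₃ * G)
            ≲⟨ +-mono-≲ (+-mono-≲ (proj₁ scaled₁) (proj₁ scaled₂)) (≲-reflexive (ι*[z*G]≈ y₃)) ⟩
          (a ^ K * α ^ B * G′ + ι * (y₁ * G′)) + (b ^ K * α ^ B * G′ + ι * (y₂ * G′)) + ι * (y₃ * G′)
            ≈⟨ solve 8 (λ p q n g ι y₁ y₂ y₃ →
                 (p :* n :* g :+ ι :* (y₁ :* g)) :+ (q :* n :* g :+ ι :* (y₂ :* g)) :+ ι :* (y₃ :* g) :=
                 (p :+ q) :* n :* g :+ ι :* ((y₁ :+ y₂ :+ y₃) :* g))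
                 refl (a ^ K) (b ^ K) (α ^ B) G′ ι y₁ y₂ y₃ ⟩
          (a ^ K + b ^ K) * α ^ B * G′ + ι * ((y₁ + y₂ + y₃) * G′)
            ≲⟨ +-mono-≲ (*-monoʳ-≲ G′ (*-monoʳ-≲ (α ^ B) (powers≲binomial a b (suc r)))) ≲-refl ⟩
          s ^ K * α ^ B * G′ + ι * ((y₁ + y₂ + y₃) * G′)  ∎) ,
          ι*-join (ι*-join (proj₂ scaled₁) (proj₂ scaled₂)) (begin
            ι * (a * b * s ^ r * α ^ B)
              ≈⟨ *-congˡ (*-congʳ (*-congˡ (^-homo-* s r₀ (k₁ ℕ.+ k₂)))) ⟩
            ι * (a * b * (s ^ r₀ * s ^ (k₁ ℕ.+ k₂)) * α ^ B)
              ≈⟨ solve 5 (λ ι m p q n → ι :* (m :* (p :* q) :* n) := ι :* (m :* p) :* q :* n)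
                   refl ι (a * b) (s ^ r₀) (s ^ (k₁ ℕ.+ k₂)) (α ^ B) ⟩
            ι * (a * b * s ^ r₀) * s ^ (k₁ ℕ.+ k₂) * α ^ B
              ≲⟨ *-monoʳ-≲ _ (*-monoʳ-≲ _ (mixed≲binomial a b)) ⟩
            s ^ (2 ℕ.+ r₀) * s ^ (k₁ ℕ.+ k₂) * α ^ B
              ≈⟨ *-congʳ (^-homo-* s (2 ℕ.+ r₀) (k₁ ℕ.+ k₂)) ⟨
            s ^ K * α ^ B          ≲⟨ *-monoʳ-≲ _ (^-mono-≲ K s≲α) ⟩
            α ^ K * α ^ B          ≈⟨ ^-homo-* α K B ⟨
            α ^ (K ℕ.+ B)          ∎)
        where
        s  = a + b
        -- The surplus in the exponent that `mixed≲binomial` requires to bound the error `y₃`.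
        r₀ = suc q ℕ.+ suc q
        r  = r₀ ℕ.+ (k₁ ℕ.+ k₂)
        K  = 2 ℕ.+ r
        B  = b₁ ℕ.+ b₂
        j₁ = 2 ℕ.+ r₀ ℕ.+ k₂
        j₂ = 2 ℕ.+ r₀ ℕ.+ k₁
        y₁ = z₁ * (a ^ j₁ * α ^ b₂)
        y₂ = z₂ * (b ^ j₂ * α ^ b₁)
        y₃ = a * b * s ^ r * α ^ B

        Scaled : ℕ → ℕ → Carrier → Carrier → Set _
        Scaled K B e y = e ^ K * α ^ B * G ≲ e ^ K * α ^ B * G′ + ι * (y * G′) × ι * y ≲ α ^ (K ℕ.+ B)

        lemma₁ : ∀ r₀ k₁ k₂ → k₁ ℕ.+ (2 ℕ.+ r₀ ℕ.+ k₂) ≡ 2 ℕ.+ (r₀ ℕ.+ (k₁ ℕ.+ k₂))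
        lemma₁ = solve-∀
        lemma₂ : ∀ r₀ k₁ k₂ → k₂ ℕ.+ (2 ℕ.+ r₀ ℕ.+ k₁) ≡ 2 ℕ.+ (r₀ ℕ.+ (k₁ ℕ.+ k₂))
        lemma₂ = solve-∀

        scaled₁ : Scaled K B a y₁
        scaled₁ = ≡.subst (λ K → Scaled K B a y₁) (lemma₁ r₀ k₁ k₂)
          (scale k₁ b₁ j₁ b₂ (≲-trans (x≲x+y a b) s≲α) a≲ z₁≲)

        scaled₂ : Scaled K B b y₂
        scaled₂ = ≡.subst₂ (λ K B → Scaled K B b y₂) (lemma₂ r₀ k₁ k₂) (ℕ.+-comm b₂ b₁)
          (scale k₂ b₂ j₂ b₁ (≲-trans (x≲y+x b a) s≲α) b≲ z₂≲)

      shiftUpToSaturated-sumClosed : SumClosedBelow α ShiftUpToSaturated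
      shiftUpToSaturated-sumClosed = record
        { P-≈  = λ u≈v (k , b , z , w≲ , z≲) → k , b , z ,
            ≲-trans (≲-reflexive (*-congʳ (*-congʳ (^-congˡ k (sym u≈v)))))
              (≲-trans w≲ (≲-reflexive (+-congʳ (*-congʳ (*-congʳ (^-congˡ k u≈v)))))) , z≲
        ; P-0  = 1 , 0 , 0# ,
            ≲-trans (≲-reflexive (solve 1 (λ g → con 0 :* con 1 :* con 1 :* g := con 0) refl G)) (0≲ _) ,
            ≲-trans (≲-reflexive (zeroʳ ι)) (0≲ _)
        ; P-+  = shiftUpToSaturated-+
        }

      shiftUpToSaturated-α : ShiftUpToSaturated α → ∃ λ k → α ^ k * G ≲ α ^ k * G′
      shiftUpToSaturated-α (k , b , z , α≲ , z≲) = k ℕ.+ b , (begin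
        α ^ (k ℕ.+ b) * G                  ≈⟨ *-congʳ (^-homo-* α k b) ⟩
        α ^ k * α ^ b * G                  ≲⟨ α≲ ⟩
        α ^ k * α ^ b * G′ + ι * (z * G′)  ≈⟨ +-congʳ (*-congʳ (^-homo-* α k b)) ⟨
        α ^ (k ℕ.+ b) * G′ + ι * (z * G′)
          ≲⟨ join (ι*-idem _) ≲-refl
               (≲-trans (≲-reflexive (sym (*-assoc ι z G′))) (*-monoʳ-≲ G′ z≲)) ⟩
        α ^ (k ℕ.+ b) * G′                 ∎)

    module _ {n k : ℕ} {f : Vec (Fin n) k → Carrier} (α≈ : sumVec semiring k f ≈ α)
             {g g′ : Carrier} (f≲ : ∀ ps → ∃ λ s → f ps ^ suc s * g ≲ α ^ suc s * g′) where

      saturatedShift : SaturatedShift g g′ α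
      saturatedShift = P-≈ α≈ (P-sumVec k (≲-reflexive α≈) λ ps →
        suc (proj₁ (f≲ ps)) , ι*-mono (proj₂ (f≲ ps)))
        where open SumClosedBelow (saturatedShift-sumClosed g g′)

      -- The equality under `ι` lets error terms change from `g` to `g′`. Removing `ι` from the
      -- conclusion costs a power of `α`.
      shift : (∀ ps → f ps ≲ α) → ∀ m → ι * (m * g) ≈ ι * (m * g′) →
        ∃ λ k → α ^ k * (m * g) ≲ α ^ k * (m * g′)
      shift f≲α m ιmg≈ = shiftUpToSaturated-α ιmg≈
        (P-≈ α≈ (P-sumVec k (≲-reflexive α≈) λ ps → single (f≲α ps) (f≲ ps)))
        where
        open SumClosedBelow (shiftUpToSaturated-sumClosed ιmg≈)
        single : ∀ {w} → w ≲ α → (∃ λ s → w ^ suc s * g ≲ α ^ suc s * g′) → ShiftUpToSaturated ιmg≈ w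
        single {w} (v , v+w≈α) (s , w≲) = shiftUpToSaturated-single ιmg≈ s (trans (+-comm w v) v+w≈α) (begin
          w ^ suc s * (m * g)   ≈⟨ solve 3 (λ p m g → p :* (m :* g) := m :* (p :* g)) refl _ m g ⟩
          m * (w ^ suc s * g)   ≲⟨ *-monoˡ-≲ m w≲ ⟩
          m * (α ^ suc s * g′)  ≈⟨ solve 3 (λ p m g → m :* (p :* g) := p :* (m :* g)) refl _ m g′ ⟩
          α ^ suc s * (m * g′)  ∎)

-- Arithmetic of exponents.

n<b^n : ∀ {b} → 1 ℕ.< b → ∀ n → n ℕ.< b ℕ.^ n
n<b^n {b} 1<b zero    = s≤s z≤n
n<b^n {b} 1<b (suc n) = ℕ.≤-<-trans (n<b^n 1<b n) (ℕ.^-monoʳ-< b 1<b (ℕ.n<1+n n))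

-- `d` divides `d !` and hence `k !`: one factorial is a common multiple of all exponent differences
-- up to `k`.
positive≤⇒∣! : ∀ {d k} → 0 ℕ.< d → d ℕ.≤ k → ∃ λ s → k ! ≡ suc s ℕ.* d
positive≤⇒∣! {suc d} {k} _ d≤k with ∣-trans (m∣m*n (d !)) (m≤n⇒m!∣n! d≤k)
... | divides (suc s) eq = s , eq
... | divides zero    eq = contradiction eq (ℕ.m<n⇒n≢0 (ℕ.1≤n! k))

+-∸-cancel : ∀ {a b} r → a ℕ.< b → a ℕ.+ r ℕ.+ (b ℕ.∸ a) ≡ b ℕ.+ r
+-∸-cancel {a} {b} r a<b = ≡.trans (lemma a r (b ℕ.∸ a)) (≡.cong (ℕ._+ r) (ℕ.m+[n∸m]≡n (ℕ.<⇒≤ a<b)))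
  where
  lemma : ∀ a r d → a ℕ.+ r ℕ.+ d ≡ a ℕ.+ d ℕ.+ r
  lemma = solve-∀

private
  4*a>2*a : ∀ a → 0 ℕ.< a → a ℕ.+ a ℕ.< 4 ℕ.* a
  4*a>2*a a 0<a = ≡.subst (a ℕ.+ a ℕ.<_) (lemma a) (ℕ.m<m+n (a ℕ.+ a) (ℕ.<-≤-trans 0<a (ℕ.m≤m+n a a)))
    where
    lemma : ∀ a → a ℕ.+ a ℕ.+ (a ℕ.+ a) ≡ 4 ℕ.* a
    lemma = solve-∀

-- Already `4 ^ (j + j)` is at least four times `4 ^ (i + j)`.
diagonalSwap< : ∀ {i j} → i ℕ.< j →
  4 ℕ.^ (i ℕ.+ j) ℕ.+ 4 ℕ.^ (j ℕ.+ i) ℕ.< 4 ℕ.^ (i ℕ.+ i) ℕ.+ 4 ℕ.^ (j ℕ.+ j)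
diagonalSwap< {i} {j} i<j = begin-strict
  4 ℕ.^ (i ℕ.+ j) ℕ.+ 4 ℕ.^ (j ℕ.+ i)  ≡⟨ ≡.cong (λ k → 4 ℕ.^ (i ℕ.+ j) ℕ.+ 4 ℕ.^ k) (ℕ.+-comm j i) ⟩
  4 ℕ.^ (i ℕ.+ j) ℕ.+ 4 ℕ.^ (i ℕ.+ j)  <⟨ 4*a>2*a (4 ℕ.^ (i ℕ.+ j)) (ℕ.m^n>0 4 (i ℕ.+ j)) ⟩
  4 ℕ.^ suc (i ℕ.+ j)                  ≤⟨ ℕ.^-monoʳ-≤ 4 (ℕ.+-monoˡ-≤ j i<j) ⟩
  4 ℕ.^ (j ℕ.+ j)                      ≤⟨ ℕ.m≤n+m _ _ ⟩
  4 ℕ.^ (i ℕ.+ i) ℕ.+ 4 ℕ.^ (j ℕ.+ j)  ∎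
  where open ℕ.≤-Reasoning

-- Both powers on the antidiagonal are `4 ^ n`, and after the swap one of the two is at least
-- `4 ^ suc n`.
antidiagonalSwap> : ∀ {n i j} → i ℕ.< j → j ℕ.≤ n →
  4 ℕ.^ (i ℕ.+ (n ℕ.∸ i)) ℕ.+ 4 ℕ.^ (j ℕ.+ (n ℕ.∸ j)) ℕ.<
  4 ℕ.^ (i ℕ.+ (n ℕ.∸ j)) ℕ.+ 4 ℕ.^ (j ℕ.+ (n ℕ.∸ i))
antidiagonalSwap> {n} {i} {j} i<j j≤n = begin-strict
  4 ℕ.^ (i ℕ.+ (n ℕ.∸ i)) ℕ.+ 4 ℕ.^ (j ℕ.+ (n ℕ.∸ j))
    ≡⟨ ≡.cong₂ (λ k l → 4 ℕ.^ k ℕ.+ 4 ℕ.^ l) (ℕ.m+[n∸m]≡n i≤n) (ℕ.m+[n∸m]≡n j≤n) ⟩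
  4 ℕ.^ n ℕ.+ 4 ℕ.^ n      <⟨ 4*a>2*a (4 ℕ.^ n) (ℕ.m^n>0 4 n) ⟩
  4 ℕ.^ suc n              ≡⟨ ≡.cong (λ k → 4 ℕ.^ suc k) (ℕ.m+[n∸m]≡n i≤n) ⟨
  4 ℕ.^ suc (i ℕ.+ (n ℕ.∸ i))  ≤⟨ ℕ.^-monoʳ-≤ 4 (ℕ.+-monoˡ-≤ (n ℕ.∸ i) i<j) ⟩
  4 ℕ.^ (j ℕ.+ (n ℕ.∸ i))  ≤⟨ ℕ.m≤n+m _ _ ⟩
  4 ℕ.^ (i ℕ.+ (n ℕ.∸ j)) ℕ.+ 4 ℕ.^ (j ℕ.+ (n ℕ.∸ i))  ∎
  where
  open ℕ.≤-Reasoning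
  i≤n = ℕ.≤-trans (ℕ.<⇒≤ i<j) j≤n

sumPowersℕ : ℕ → List ℕ → ℕ
sumPowersℕ b []       = 0
sumPowersℕ b (e ∷ es) = b ℕ.^ e ℕ.+ sumPowersℕ b es

sumPowersℕ-bound : ∀ b d {es} → All (ℕ._< d) es → b ℕ.* sumPowersℕ b es ℕ.≤ length es ℕ.* b ℕ.^ d
sumPowersℕ-bound zero    d []         = z≤n
sumPowersℕ-bound zero    d (_ ∷ _)    = z≤n
sumPowersℕ-bound (suc b) d []         = ℕ.≤-reflexive (ℕ.*-zeroʳ b)
sumPowersℕ-bound b@(suc _) d {e ∷ es} (e<d ∷ es<d) = begin
  b ℕ.* (b ℕ.^ e ℕ.+ sumPowersℕ b es)         ≡⟨ ℕ.*-distribˡ-+ b (b ℕ.^ e) _ ⟩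
  b ℕ.^ suc e ℕ.+ b ℕ.* sumPowersℕ b es       ≤⟨ ℕ.+-mono-≤ (ℕ.^-monoʳ-≤ b e<d) (sumPowersℕ-bound b d es<d) ⟩
  b ℕ.^ d ℕ.+ length es ℕ.* b ℕ.^ d           ∎
  where open ℕ.≤-Reasoning

sumPowersℕ-< : ∀ {b d es} → length es ℕ.< b → All (ℕ._< d) es → sumPowersℕ b es ℕ.< b ℕ.^ d
sumPowersℕ-< {b@(suc _)} {d} {es} len< es< = ℕ.*-cancelˡ-< b _ _ (begin-strict
  b ℕ.* sumPowersℕ b es    ≤⟨ sumPowersℕ-bound b d es< ⟩
  length es ℕ.* b ℕ.^ d    <⟨ ℕ.*-monoˡ-< (b ℕ.^ d) {{ℕ.m^n≢0 b d}} len< ⟩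
  b ℕ.* b ℕ.^ d            ∎)
  where open ℕ.≤-Reasoning

-- Finite additive order of 1.

module FiniteCharacteristic {c ℓ} (S : CommutativeSemiring c ℓ) where

  open CommutativeSemiring S hiding (zero)
  open import Algebra.Properties.CommutativeSemiring.Exp S
  open import Algebra.Properties.Semiring.Mult semiring
    using (×-congˡ; ×-homo-+; ×-homo-1; ×1-homo-*) renaming (_×_ to _·_)
  open HankelRank S
  open Determinant S using (sumPowers; hankelRank⇒monic)
  open Saturation S using (Saturating)
  open import Relation.Binary.Reasoning.Setoid setoid

  ·1-homo-^ : ∀ b e → (b · 1#) ^ e ≈ (b ℕ.^ e) · 1#
  ·1-homo-^ b zero    = sym (×-homo-1 1#)
  ·1-homo-^ b (suc e) = trans (*-congˡ (·1-homo-^ b e)) (sym (×1-homo-* b (b ℕ.^ e)))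

  sumPowers-·1 : ∀ b es → sumPowers (b · 1#) es ≈ sumPowersℕ b es · 1#
  sumPowers-·1 b []       = refl
  sumPowers-·1 b (e ∷ es) = trans (+-cong (·1-homo-^ b e) (sumPowers-·1 b es))
    (sym (×-homo-+ 1# (b ℕ.^ e) (sumPowersℕ b es)))

  sumPowers-cong : ∀ {x y} es → x ≈ y → sumPowers x es ≈ sumPowers y es
  sumPowers-cong []       x≈y = refl
  sumPowers-cong (e ∷ es) x≈y = +-cong (^-congˡ e x≈y) (sumPowers-cong es x≈y)

  FiniteAdditiveOrder : Set ℓ
  FiniteAdditiveOrder = ∃₂ λ a b → a ℕ.< b × a · 1# ≈ b · 1#

  -- The monic identity, evaluated at a power of 2 that exceeds the number of its summands.
  hankelRank⇒finiteAdditiveOrder : ∀ {n} → HankelRank n (2 · 1#) → FiniteAdditiveOrder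
  hankelRank⇒finiteAdditiveOrder {n} rank with hankelRank⇒monic n
  ... | d , es , fs , _ , fs< , monic =
    sumPowersℕ β fs , sumPowersℕ β (d ∷ es) ,
    ℕ.<-≤-trans (sumPowersℕ-< length<β fs<) (ℕ.m≤m+n _ _) , (begin
      sumPowersℕ β fs · 1#         ≈⟨ sumPowers-·1 β fs ⟨
      sumPowers (β · 1#) fs        ≈⟨ sumPowers-cong fs X≈ ⟨
      sumPowers X fs               ≈⟨ monic X (hankelRank-power t rank) ⟨
      sumPowers X (d ∷ es)         ≈⟨ sumPowers-cong (d ∷ es) X≈ ⟩
      sumPowers (β · 1#) (d ∷ es)  ≈⟨ sumPowers-·1 β (d ∷ es) ⟩
      sumPowersℕ β (d ∷ es) · 1#   ∎)
    where
    -- `hankelRank-power` supplies exponents of the form `4 ^ t`; the number of summands is a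
    -- sufficient `t`, as `t < 4 ^ t < β`.
    t = length fs
    β = 2 ℕ.^ (4 ℕ.^ t)
    X = (2 · 1#) ^ (4 ℕ.^ t)

    X≈ : X ≈ β · 1#
    X≈ = ·1-homo-^ 2 (4 ℕ.^ t)

    length<β : t ℕ.< β
    length<β = ℕ.<-trans (n<b^n (s≤s (s≤s z≤n)) t) (n<b^n (s≤s (s≤s z≤n)) (4 ℕ.^ t))

  finiteAdditiveOrder⇒saturating : FiniteAdditiveOrder → Saturating
  finiteAdditiveOrder⇒saturating (a , b , a<b , a≈b) with ℕ.m≤n⇒∃[o]m+o≡n a<b
  ... | o , ≡.refl = record
    { ι     = suc q · 1#
    ; q     = q
    ; ι≈    = refl
    ; ι+ι≈ι = begin
        suc q · 1# + suc q · 1#          ≈⟨ ×-homo-+ 1# (suc q) (suc q) ⟨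
        (suc q ℕ.+ suc q) · 1#           ≈⟨ ×-congˡ (≡.cong (ℕ._+ suc a ℕ.* suc o) (lemma a o)) ⟩
        (i ℕ.+ a ℕ.+ suc a ℕ.* suc o) · 1#  ≈⟨ drop (suc a) ⟩
        (i ℕ.+ a) · 1#                   ≈⟨ ×-congˡ (lemma a o) ⟨
        suc q · 1#                       ∎
    }
    where
    -- `b` is `suc a + o`, so `suc o` is a period. Its multiple `suc q = suc a * suc o` exceeds `a`,
    -- hence gives an idempotent among the multiples of `1#`; `i` is the difference of `suc q` and
    -- `a`.
    q = o ℕ.+ a ℕ.* suc o
    i = suc o ℕ.+ a ℕ.* o

    lemma : ∀ a o → suc a ℕ.* suc o ≡ suc o ℕ.+ a ℕ.* o ℕ.+ a
    lemma = solve-∀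

    lemma′ : ∀ i a o k → i ℕ.+ a ℕ.+ (suc o ℕ.+ k) ≡ i ℕ.+ k ℕ.+ (suc a ℕ.+ o)
    lemma′ = solve-∀

    lemma″ : ∀ i a k → i ℕ.+ k ℕ.+ a ≡ i ℕ.+ a ℕ.+ k
    lemma″ = solve-∀

    drop : ∀ j → (i ℕ.+ a ℕ.+ j ℕ.* suc o) · 1# ≈ (i ℕ.+ a) · 1#
    drop zero    = ×-congˡ (ℕ.+-identityʳ (i ℕ.+ a))
    drop (suc j) = begin
      (i ℕ.+ a ℕ.+ (suc o ℕ.+ j ℕ.* suc o)) · 1#          ≈⟨ ×-congˡ (lemma′ i a o (j ℕ.* suc o)) ⟩
      (i ℕ.+ j ℕ.* suc o ℕ.+ (suc a ℕ.+ o)) · 1#          ≈⟨ ×-homo-+ 1# (i ℕ.+ j ℕ.* suc o) (suc a ℕ.+ o) ⟩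
      (i ℕ.+ j ℕ.* suc o) · 1# + (suc a ℕ.+ o) · 1#       ≈⟨ +-congˡ a≈b ⟨
      (i ℕ.+ j ℕ.* suc o) · 1# + a · 1#                   ≈⟨ ×-homo-+ 1# (i ℕ.+ j ℕ.* suc o) a ⟨
      (i ℕ.+ j ℕ.* suc o ℕ.+ a) · 1#                      ≈⟨ ×-congˡ (lemma″ i a (j ℕ.* suc o)) ⟩
      (i ℕ.+ a ℕ.+ j ℕ.* suc o) · 1#                      ≈⟨ drop j ⟩
      (i ℕ.+ a) · 1#                                      ∎

-- Colourings of products of Hankel entries.

module Colorings {c ℓ} (S : CommutativeSemiring c ℓ) where

  open CommutativeSemiring S hiding (zero)
  open import Algebra.Properties.CommutativeSemiring.Exp S
  open import Algebra.Properties.Semiring.Sum semiring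
  open CommutativeMonoidSum *-commutativeMonoid using ()
    renaming (sum to product; sum-remove to product-remove; sum-cong-≋ to product-cong)
  open import Algebra.Solver.Ring.NaturalCoefficients.Default S using (solve; _:=_; _:*_; con)
  open HankelRank S
  open NaturalOrder S
  open Saturation S
  open Shift S
  open import Relation.Binary.Reasoning.Preorder ≲-preorder

  *-distribˡ-sumVec : ∀ {n} k a (f : Vec (Fin n) k → Carrier) →
    a * sumVec semiring k f ≈ sumVec semiring k (λ ps → a * f ps)
  *-distribˡ-sumVec zero    a f = refl
  *-distribˡ-sumVec (suc k) a f = trans
    (*-distribˡ-sum a (λ p → sumVec semiring k (λ ps → f (p ∷ ps))))
    (sum-cong-≋ (λ p → *-distribˡ-sumVec k a (λ ps → f (p ∷ ps))))

  sumVec-product : ∀ {n} k (v : Fin k → Fin n → Carrier) →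
    sumVec semiring k (λ ps → product (λ i → v i (lookup ps i))) ≈ product (λ i → sum (v i))
  sumVec-product zero    v = refl
  sumVec-product (suc k) v = begin-equality
    sum (λ p → sumVec semiring k (λ ps → v zero p * product (λ i → v (suc i) (lookup ps i))))
      ≈⟨ sum-cong-≋ (λ p → sym (*-distribˡ-sumVec k (v zero p) (λ ps → product (λ i → v (suc i) (lookup ps i))))) ⟩
    sum (λ p → v zero p * sumVec semiring k (λ ps → product (λ i → v (suc i) (lookup ps i))))
      ≈⟨ *-distribʳ-sum (sumVec semiring k (λ ps → product (λ i → v (suc i) (lookup ps i)))) (v zero) ⟨
    sum (v zero) * sumVec semiring k (λ ps → product (λ i → v (suc i) (lookup ps i)))
      ≈⟨ *-congˡ (sumVec-product k (λ i → v (suc i))) ⟩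
    product (λ i → sum (v i))  ∎

  product-^ : ∀ {k} x (e : Fin k → ℕ) → product (λ i → x ^ e i) ≈ x ^ sumℕ e
  product-^ {zero}  x e = refl
  product-^ {suc k} x e = trans (*-congˡ (product-^ x (λ i → e (suc i)))) (sym (^-homo-* x (e zero) _))

  product-mono-≲ : ∀ {k} {f g : Fin k → Carrier} → (∀ i → f i ≲ g i) → product f ≲ product g
  product-mono-≲ {zero}  f≲g = ≲-refl
  product-mono-≲ {suc k} f≲g = *-mono-≲ (f≲g zero) (product-mono-≲ (λ i → f≲g (suc i)))

  -- The factors `i` and `j` are bounded jointly, the others one by one with total exponent `r`. The
  -- equation for `sumℕ e` allows `p + r` to be compared with the full degree.
  product-≲-pair : ∀ {k x} {f : Fin k → Carrier} (e : Fin k → ℕ) {i j p} → i ≢ j →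
    f i * f j ≲ x ^ p → (∀ i → f i ≲ x ^ e i) →
    ∃ λ r → product f ≲ x ^ (p ℕ.+ r) × sumℕ e ≡ e i ℕ.+ e j ℕ.+ r
  product-≲-pair {suc zero} e {zero} {zero} i≢j with () ← i≢j ≡.refl
  product-≲-pair {suc (suc k)} {x} {f} e {i} {j} {p} i≢j fᵢfⱼ≲ f≲ = sumℕ e″ , (begin
    product f                   ≈⟨ product-remove f ⟩
    f i * product f′            ≈⟨ *-congˡ (product-remove f′) ⟩
    f i * (f′ j′ * product f″)  ≡⟨ ≡.cong (λ j → f i * (f j * product f″)) (punchIn-punchOut i≢j) ⟩
    f i * (f j * product f″)    ≈⟨ *-assoc (f i) (f j) _ ⟨
    f i * f j * product f″
      ≲⟨ *-mono-≲ fᵢfⱼ≲ (product-mono-≲ (λ k → f≲ (Fin.punchIn i (Fin.punchIn j′ k)))) ⟩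
    x ^ p * product (λ k → x ^ e″ k)  ≈⟨ *-congˡ (product-^ x e″) ⟩
    x ^ p * x ^ sumℕ e″               ≈⟨ ^-homo-* x p (sumℕ e″) ⟨
    x ^ (p ℕ.+ sumℕ e″)               ∎) ,
    ≡.trans (sumℕ-remove {i = i} e) (≡.trans
      (≡.cong (e i ℕ.+_) (≡.trans (sumℕ-remove {i = j′} e′)
        (≡.cong (λ j → e j ℕ.+ sumℕ e″) (punchIn-punchOut i≢j))))
      (≡.sym (ℕ.+-assoc (e i) (e j) _)))
    where
    j′ = punchOut i≢j
    f′ = removeAt f i
    f″ = removeAt f′ j′
    e′ = removeAt e i
    e″ = removeAt e′ j′

  -- Each factor `w` falls short of `x ^ a` by at least `x ^ d`. As `d` divides `bound !`, a
  -- suitable power accumulates the deficit `bound !`, which is the same for all `w`.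
  powerShiftDown : ∀ {x w a bound} b d → w ≲ x ^ b → b ℕ.+ d ≡ a → 0 ℕ.< d → d ℕ.≤ bound →
    ∃ λ s → w ^ suc s * x ^ (bound !) ≲ (x ^ a) ^ suc s * 1#
  powerShiftDown {x} {w} {_} {bound} b d w≲ ≡.refl 0<d d≤ = s , (begin
    w ^ suc s * x ^ (bound !)                    ≲⟨ *-monoʳ-≲ _ (^-mono-≲ (suc s) w≲) ⟩
    (x ^ b) ^ suc s * x ^ (bound !)
      ≈⟨ *-cong (^-assocʳ x b (suc s)) (^-congʳ x (proj₂ factor)) ⟩
    x ^ (b ℕ.* suc s) * x ^ (suc s ℕ.* d)      ≈⟨ ^-homo-* x (b ℕ.* suc s) (suc s ℕ.* d) ⟨
    x ^ (b ℕ.* suc s ℕ.+ suc s ℕ.* d)          ≈⟨ ^-congʳ x (lemma b d (suc s)) ⟩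
    x ^ ((b ℕ.+ d) ℕ.* suc s)                  ≈⟨ ^-assocʳ x (b ℕ.+ d) (suc s) ⟨
    (x ^ (b ℕ.+ d)) ^ suc s                    ≈⟨ *-identityʳ _ ⟨
    (x ^ (b ℕ.+ d)) ^ suc s * 1#               ∎)
    where
    factor = positive≤⇒∣! 0<d d≤
    s      = proj₁ factor

    lemma : ∀ b d s → b ℕ.* s ℕ.+ s ℕ.* d ≡ (b ℕ.+ d) ℕ.* s
    lemma = solve-∀

  powerShiftUp : ∀ {x w bound} a d → w ≲ x ^ (a ℕ.+ d) → 0 ℕ.< d → d ℕ.≤ bound →
    ∃ λ s → w ^ suc s * 1# ≲ (x ^ a) ^ suc s * x ^ (bound !)
  powerShiftUp {x} {w} {bound} a d w≲ 0<d d≤ = s , (begin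
    w ^ suc s * 1#                             ≈⟨ *-identityʳ _ ⟩
    w ^ suc s                                  ≲⟨ ^-mono-≲ (suc s) w≲ ⟩
    (x ^ (a ℕ.+ d)) ^ suc s                    ≈⟨ ^-assocʳ x (a ℕ.+ d) (suc s) ⟩
    x ^ ((a ℕ.+ d) ℕ.* suc s)                  ≈⟨ ^-congʳ x (lemma a d (suc s)) ⟩
    x ^ (a ℕ.* suc s ℕ.+ suc s ℕ.* d)          ≈⟨ ^-homo-* x (a ℕ.* suc s) (suc s ℕ.* d) ⟩
    x ^ (a ℕ.* suc s) * x ^ (suc s ℕ.* d)
      ≈⟨ *-cong (^-assocʳ x a (suc s)) (^-congʳ x (proj₂ factor)) ⟨
    (x ^ a) ^ suc s * x ^ (bound !)              ∎)
    where
    factor = positive≤⇒∣! 0<d d≤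
    s      = proj₁ factor

    lemma : ∀ a d s → (a ℕ.+ d) ℕ.* s ≡ a ℕ.* s ℕ.+ s ℕ.* d
    lemma = solve-∀

  module _ {n : ℕ} {x : Carrier} (rank : HankelRank n x)
           {k : ℕ} (n<k : n ℕ.< k) (σ τ : Fin k → ℕ) where

    private
      l  = proj₁ rank
      r  = proj₁ (proj₂ rank)
      lr = proj₂ (proj₂ rank)

    -- One term in the expansion of the product of the entries at `(σ i , τ i)`; factor `i` uses the
    -- summand, or colour, `lookup ps i`.
    coloring : Vec (Fin n) k → Carrier
    coloring ps = product (λ i → l (σ i) (lookup ps i) * r (τ i) (lookup ps i))

    degree : ℕ
    degree = sumℕ (λ i → 4 ℕ.^ (σ i ℕ.+ τ i))

    sumVec-coloring : sumVec semiring k coloring ≈ x ^ degree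
    sumVec-coloring = begin-equality
      sumVec semiring k coloring
        ≈⟨ sumVec-product k (λ i p → l (σ i) p * r (τ i) p) ⟩
      product (λ i → sum (λ p → l (σ i) p * r (τ i) p))
        ≈⟨ product-cong (λ i → lr (σ i) (τ i)) ⟩
      product (λ i → x ^ (4 ℕ.^ (σ i ℕ.+ τ i)))
        ≈⟨ product-^ x (λ i → 4 ℕ.^ (σ i ℕ.+ τ i)) ⟩
      x ^ degree  ∎

    entry≲ : ∀ i j p → l i p * r j p ≲ x ^ (4 ℕ.^ (i ℕ.+ j))
    entry≲ i j p = ≲-trans (summand≲sum (λ p → l i p * r j p) p) (≲-reflexive (lr i j))

    coloring≲ : ∀ ps → coloring ps ≲ x ^ degree
    coloring≲ ps = ≲-trans (product-mono-≲ (λ i → entry≲ (σ i) (τ i) (lookup ps i)))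
      (≲-reflexive (product-^ x (λ i → 4 ℕ.^ (σ i ℕ.+ τ i))))

    swapped : Fin k → Fin k → ℕ
    swapped i j = 4 ℕ.^ (σ i ℕ.+ τ j) ℕ.+ 4 ℕ.^ (σ j ℕ.+ τ i)

    unswapped : Fin k → Fin k → ℕ
    unswapped i j = 4 ℕ.^ (σ i ℕ.+ τ i) ℕ.+ 4 ℕ.^ (σ j ℕ.+ τ j)

    -- Two rows of the same colour can exchange their columns.
    coloring≲swapped : ∀ ps → ∃₂ λ i j → i Fin.< j ×
      ∃ λ r → coloring ps ≲ x ^ (swapped i j ℕ.+ r) × degree ≡ unswapped i j ℕ.+ r
    coloring≲swapped ps with i , j , i<j , eq ← pigeonhole n<k (lookup ps) =
      i , j , i<j , product-≲-pair (λ i → 4 ℕ.^ (σ i ℕ.+ τ i)) {p = swapped i j} (<⇒≢ i<j) (begin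
        l (σ i) (lookup ps i) * r (τ i) (lookup ps i) * (l (σ j) (lookup ps j) * r (τ j) (lookup ps j))
          ≡⟨ ≡.cong (λ p → l (σ i) (lookup ps i) * r (τ i) (lookup ps i) * (l (σ j) p * r (τ j) p)) eq ⟨
        l (σ i) (lookup ps i) * r (τ i) (lookup ps i) * (l (σ j) (lookup ps i) * r (τ j) (lookup ps i))
          ≈⟨ solve 4 (λ a b c d → a :* b :* (c :* d) := a :* d :* (c :* b)) refl _ _ _ _ ⟩
        l (σ i) (lookup ps i) * r (τ j) (lookup ps i) * (l (σ j) (lookup ps i) * r (τ i) (lookup ps i))
          ≲⟨ *-mono-≲ (entry≲ (σ i) (τ j) _) (entry≲ (σ j) (τ i) _) ⟩
        x ^ (4 ℕ.^ (σ i ℕ.+ τ j)) * x ^ (4 ℕ.^ (σ j ℕ.+ τ i))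
          ≈⟨ ^-homo-* x (4 ℕ.^ (σ i ℕ.+ τ j)) (4 ℕ.^ (σ j ℕ.+ τ i)) ⟨
        x ^ swapped i j  ∎) (λ i → entry≲ (σ i) (τ i) (lookup ps i))

    coloring-shiftDown : ∀ bound →
      (∀ i j → i Fin.< j → swapped i j ℕ.< unswapped i j × unswapped i j ℕ.≤ bound) →
      ∀ ps → ∃ λ s → coloring ps ^ suc s * x ^ (bound !) ≲ (x ^ degree) ^ suc s * 1#
    coloring-shiftDown bound smaller ps =
      let i , j , i<j , r , ps≲ , deg≡ = coloring≲swapped ps
          s<u , u≤                     = smaller i j i<j
      in powerShiftDown (swapped i j ℕ.+ r) (unswapped i j ℕ.∸ swapped i j) ps≲
           (≡.trans (+-∸-cancel r s<u) (≡.sym deg≡))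
           (ℕ.m<n⇒0<n∸m s<u) (ℕ.≤-trans (ℕ.m∸n≤m (unswapped i j) (swapped i j)) u≤)

    coloring-shiftUp : ∀ bound →
      (∀ i j → i Fin.< j → unswapped i j ℕ.< swapped i j × swapped i j ℕ.≤ bound) →
      ∀ ps → ∃ λ s → coloring ps ^ suc s * 1# ≲ (x ^ degree) ^ suc s * x ^ (bound !)
    coloring-shiftUp bound larger ps =
      let i , j , i<j , r , ps≲ , deg≡ = coloring≲swapped ps
          u<s , s≤                     = larger i j i<j
      in powerShiftUp degree (swapped i j ℕ.∸ unswapped i j)
           (≡.subst (λ b → coloring ps ≲ x ^ b)
             (≡.sym (≡.trans (≡.cong (ℕ._+ (swapped i j ℕ.∸ unswapped i j)) deg≡) (+-∸-cancel r u<s))) ps≲)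
           (ℕ.m<n⇒0<n∸m u<s) (ℕ.≤-trans (ℕ.m∸n≤m (swapped i j) (unswapped i j)) s≤)

  -- Up to the natural preorder, the powers of x are eventually periodic: rows and columns in the
  -- same order give one inequality, rows and columns in opposite order the other.
  hankelRank⇒orderPeriodic : Saturating → ∀ {n x} → HankelRank n x →
    ∃₂ λ b p → 0 ℕ.< p × x ^ b * x ^ p ≲ x ^ b × x ^ b ≲ x ^ b * x ^ p
  hankelRank⇒orderPeriodic σ {n} {x} rank =
    -- This exponent provides the factors `α ^ k`, `α′ ^ k′` and `m` that the two applications of
    -- `shift` consume.
    A ℕ.* k ℕ.+ A′ ℕ.* k′ ℕ.+ M , L , ℕ.1≤n! bound , (begin
      x ^ (A ℕ.* k ℕ.+ A′ ℕ.* k′ ℕ.+ M) * x ^ L  ≈⟨ *-congʳ split ⟩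
      α ^ k * α′ ^ k′ * m * x ^ L
        ≈⟨ solve 4 (λ a b m l → a :* b :* m :* l := b :* (a :* (m :* l))) refl (α ^ k) (α′ ^ k′) m (x ^ L) ⟩
      α′ ^ k′ * (α ^ k * (m * x ^ L))            ≲⟨ *-monoˡ-≲ _ (proj₂ down) ⟩
      α′ ^ k′ * (α ^ k * (m * 1#))
        ≈⟨ solve 3 (λ a b m → b :* (a :* (m :* con 1)) := a :* b :* m) refl (α ^ k) (α′ ^ k′) m ⟩
      α ^ k * α′ ^ k′ * m                        ≈⟨ split ⟨
      x ^ (A ℕ.* k ℕ.+ A′ ℕ.* k′ ℕ.+ M)          ∎) , (begin
      x ^ (A ℕ.* k ℕ.+ A′ ℕ.* k′ ℕ.+ M)          ≈⟨ split ⟩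
      α ^ k * α′ ^ k′ * m
        ≈⟨ solve 3 (λ a b m → a :* b :* m := a :* (b :* (m :* con 1))) refl (α ^ k) (α′ ^ k′) m ⟩
      α ^ k * (α′ ^ k′ * (m * 1#))               ≲⟨ *-monoˡ-≲ _ (proj₂ up) ⟩
      α ^ k * (α′ ^ k′ * (m * x ^ L))
        ≈⟨ solve 4 (λ a b m l → a :* (b :* (m :* l)) := a :* b :* m :* l) refl (α ^ k) (α′ ^ k′) m (x ^ L) ⟩
      α ^ k * α′ ^ k′ * m * x ^ L                ≈⟨ *-congʳ split ⟨
      x ^ (A ℕ.* k ℕ.+ A′ ℕ.* k′ ℕ.+ M) * x ^ L  ∎)
    where
    open Saturating σ
    open SaturatingLaws σ

    N = suc n
    -- No two entries with indices up to `n` have a larger total exponent, so every exponent change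
    -- caused by a swap divides `L`.
    bound = 4 ℕ.^ (n ℕ.+ n) ℕ.+ 4 ℕ.^ (n ℕ.+ n)
    L = bound !
    n<N = ℕ.n<1+n n

    column : Fin N → ℕ
    column i = n ℕ.∸ toℕ i

    toℕ≤n : ∀ (i : Fin N) → toℕ i ℕ.≤ n
    toℕ≤n = toℕ≤pred[n]

    column≤n : ∀ i → column i ℕ.≤ n
    column≤n i = ℕ.m∸n≤m n (toℕ i)

    ≤bound : ∀ {a b c d} → a ℕ.≤ n → b ℕ.≤ n → c ℕ.≤ n → d ℕ.≤ n →
      4 ℕ.^ (a ℕ.+ b) ℕ.+ 4 ℕ.^ (c ℕ.+ d) ℕ.≤ bound
    ≤bound a≤ b≤ c≤ d≤ = ℕ.+-mono-≤ (ℕ.^-monoʳ-≤ 4 (ℕ.+-mono-≤ a≤ b≤)) (ℕ.^-monoʳ-≤ 4 (ℕ.+-mono-≤ c≤ d≤))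

    A  = degree rank n<N toℕ toℕ
    A′ = degree rank n<N toℕ column
    α  = x ^ A
    α′ = x ^ A′

    downs = coloring-shiftDown rank n<N toℕ toℕ bound λ i j i<j →
      diagonalSwap< i<j , ≤bound (toℕ≤n i) (toℕ≤n i) (toℕ≤n j) (toℕ≤n j)

    ups = coloring-shiftUp rank n<N toℕ column bound λ i j i<j →
      antidiagonalSwap> i<j (toℕ≤n j) , ≤bound (toℕ≤n i) (column≤n j) (toℕ≤n j) (column≤n i)

    satDown = saturatedShift σ α (sumVec-coloring rank n<N toℕ toℕ) downs
    satUp   = saturatedShift σ α′ (sumVec-coloring rank n<N toℕ column) ups

    s = proj₁ satDown
    t = proj₁ satUp
    M = A ℕ.* s ℕ.+ A′ ℕ.* t
    -- With both factors in `m`, the two saturated inequalities concern the same elements: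
    -- `ι * (m * x ^ L)` and `ι * (m * 1#)` bound each other. Being idempotent they are equal, as
    -- `shift` demands.
    m = α ^ s * α′ ^ t

    ιm≈ : ι * (m * x ^ L) ≈ ι * (m * 1#)
    ιm≈ = antisym (ι*-idem _) (ι*-idem _) (begin
      ι * (m * x ^ L)
        ≈⟨ solve 4 (λ ι a b l → ι :* (a :* b :* l) := b :* (ι :* (a :* l))) refl ι (α ^ s) (α′ ^ t) (x ^ L) ⟩
      α′ ^ t * (ι * (α ^ s * x ^ L))  ≲⟨ *-monoˡ-≲ _ (proj₂ satDown) ⟩
      α′ ^ t * (ι * (α ^ s * 1#))
        ≈⟨ solve 3 (λ ι a b → b :* (ι :* (a :* con 1)) := ι :* (a :* b :* con 1)) refl ι (α ^ s) (α′ ^ t) ⟩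
      ι * (m * 1#)  ∎) (begin
      ι * (m * 1#)
        ≈⟨ solve 3 (λ ι a b → ι :* (a :* b :* con 1) := a :* (ι :* (b :* con 1))) refl ι (α ^ s) (α′ ^ t) ⟩
      α ^ s * (ι * (α′ ^ t * 1#))     ≲⟨ *-monoˡ-≲ _ (proj₂ satUp) ⟩
      α ^ s * (ι * (α′ ^ t * x ^ L))
        ≈⟨ solve 4 (λ ι a b l → a :* (ι :* (b :* l)) := ι :* (a :* b :* l)) refl ι (α ^ s) (α′ ^ t) (x ^ L) ⟩
      ι * (m * x ^ L)  ∎)

    down = shift σ α (sumVec-coloring rank n<N toℕ toℕ) downs (coloring≲ rank n<N toℕ toℕ) m ιm≈
    up   = shift σ α′ (sumVec-coloring rank n<N toℕ column) ups (coloring≲ rank n<N toℕ column) m (sym ιm≈)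

    k  = proj₁ down
    k′ = proj₁ up

    powers : ∀ i j → x ^ (A ℕ.* i ℕ.+ A′ ℕ.* j) ≈ α ^ i * α′ ^ j
    powers i j = trans (^-homo-* x (A ℕ.* i) (A′ ℕ.* j))
      (sym (*-cong (^-assocʳ x A i) (^-assocʳ x A′ j)))

    split : x ^ (A ℕ.* k ℕ.+ A′ ℕ.* k′ ℕ.+ M) ≈ α ^ k * α′ ^ k′ * m
    split = trans (^-homo-* x (A ℕ.* k ℕ.+ A′ ℕ.* k′) M) (*-cong (powers k k′) (powers s t))

-- Finite orders and finitely generated subsemirings.

module FinitePowers {c ℓ} (S : CommutativeSemiring c ℓ) where

  open CommutativeSemiring S hiding (zero)
  open import Algebra.Properties.CommutativeSemiring.Exp S
  open import Algebra.Properties.Semiring.Mult semiring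
    using (×-congʳ; ×-assoc-*) renaming (_×_ to _·_)
  open import Algebra.Properties.CommutativeSemigroup +-commutativeSemigroup using (xy∙z≈xz∙y)
  open import Algebra.Solver.Ring.NaturalCoefficients.Default S using (solve; _:=_; _:+_; _:*_)
  open import Data.List.Membership.Setoid setoid using (_∈_)
  open HankelRank S
  open Determinant S using (sumPowers; sumPowers-shift; hankelRank⇒monic)
  open NaturalOrder S
  open Saturation S
  open FiniteCharacteristic S
  open Colorings S
  module Additive       = Combinations +-commutativeMonoid
  module Multiplicative = Combinations *-commutativeMonoid

  finiteAdditiveOrder : FiniteAdditiveOrder → ∀ u → Additive.FiniteOrder u
  finiteAdditiveOrder (a , b , a<b , a≈b) u = a , b , a<b , (begin
    a · u         ≈⟨ multiple a ⟨
    a · 1# * u    ≈⟨ *-congʳ a≈b ⟩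
    b · 1# * u    ≈⟨ multiple b ⟩
    b · u         ∎)
    where
    open import Relation.Binary.Reasoning.Setoid setoid
    multiple : ∀ k → k · 1# * u ≈ k · u
    multiple k = trans (×-assoc-* k 1# u) (×-congʳ k (*-identityˡ u))

  -- Among `length us + 1` of these elements two share an index in `us`; `0 < p` keeps their
  -- exponents apart.
  repetition⇒finiteOrder : ∀ {x} b p → 0 ℕ.< p → (us : List Carrier) →
    (∀ i → x ^ b * (x ^ p) ^ i ∈ us) → Multiplicative.FiniteOrder x
  repetition⇒finiteOrder {x} b p 0<p us x∈us
    with i , j , i<j , eq ← pigeonhole (ℕ.n<1+n (length us)) (λ i → index (x∈us (toℕ i))) =
    b ℕ.+ p ℕ.* toℕ i , b ℕ.+ p ℕ.* toℕ j ,
    ℕ.+-monoʳ-< b (ℕ.*-monoʳ-< p {{ℕ.>-nonZero 0<p}} i<j) , (begin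
      x ^ (b ℕ.+ p ℕ.* toℕ i)                 ≈⟨ power (toℕ i) ⟩
      x ^ b * (x ^ p) ^ toℕ i                 ≈⟨ Any.lookup-index (x∈us (toℕ i)) ⟩
      List.lookup us (index (x∈us (toℕ i)))   ≡⟨ ≡.cong (List.lookup us) eq ⟩
      List.lookup us (index (x∈us (toℕ j)))   ≈⟨ Any.lookup-index (x∈us (toℕ j)) ⟨
      x ^ b * (x ^ p) ^ toℕ j                 ≈⟨ power (toℕ j) ⟨
      x ^ (b ℕ.+ p ℕ.* toℕ j)                 ∎)
    where
    open import Relation.Binary.Reasoning.Setoid setoid
    power : ∀ k → x ^ (b ℕ.+ p ℕ.* k) ≈ x ^ b * (x ^ p) ^ k
    power k = trans (^-homo-* x b (p ℕ.* k)) (*-congˡ (sym (^-assocʳ x p k)))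

  -- If w and w * y bound each other, they differ by a multiple of d that w cannot tell from its
  -- negative; modulo the ι * (d * y ^ j), all absorbed by w, the multiples of d form a module
  -- over which y satisfies a monic equation, so that w * y ^ i takes finitely many values.
  module _ (σ : Saturating) (finite : FiniteAdditiveOrder)
           {y w d d′ : Carrier} (d+w≈wy : d + w ≈ w * y) (d′+wy≈w : d′ + w * y ≈ w) where

    open Saturating σ
    open SaturatingLaws σ

    w*y^≲w : ∀ i → w * y ^ i ≲ w
    w*y^≲w zero    = ≲-reflexive (*-identityʳ w)
    w*y^≲w (suc i) = ≲-trans (≲-reflexive (sym (*-assoc w y _)))
      (≲-trans (*-monoʳ-≲ (y ^ i) (d′ , d′+wy≈w)) (w*y^≲w i))

    -- Adding `(d + d′) * y ^ i` leaves `w * y ^ i` unchanged, so `suc q` copies of it, which amount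
    -- to `ι` times it, lie below `w * y ^ i` and thus below `w`.
    ι*dy^≲w : ∀ i → ι * (d * y ^ i) ≲ w
    ι*dy^≲w i = ≲-trans (begin
      ι * (d * y ^ i)                         ≲⟨ ι*-mono (*-monoʳ-≲ (y ^ i) (x≲x+y d d′)) ⟩
      ι * z                                   ≈⟨ multiple≈ι* z ⟨
      suc q · z                               ≲⟨ x≲x+y _ (w * y ^ i) ⟩
      suc q · z + w * y ^ i                   ≈⟨ absorbs (suc q) ⟩
      w * y ^ i                               ∎) (w*y^≲w i)
      where
      open import Relation.Binary.Reasoning.Preorder ≲-preorder
      z = (d + d′) * y ^ i

      absorbs₁ : z + w * y ^ i ≈ w * y ^ i
      absorbs₁ = begin-equality
        (d + d′) * y ^ i + w * y ^ i
          ≈⟨ solve 4 (λ d d′ y w → (d :+ d′) :* y :+ w :* y := (d′ :+ (d :+ w)) :* y) refl d d′ (y ^ i) w ⟩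
        (d′ + (d + w)) * y ^ i  ≈⟨ *-congʳ (+-congˡ d+w≈wy) ⟩
        (d′ + w * y) * y ^ i    ≈⟨ *-congʳ d′+wy≈w ⟩
        w * y ^ i               ∎

      absorbs : ∀ k → k · z + w * y ^ i ≈ w * y ^ i
      absorbs zero    = +-identityˡ _
      absorbs (suc k) = trans (+-assoc z _ _) (trans (+-congˡ (absorbs k)) absorbs₁)

    module _ {D : ℕ} {es fs : List ℕ} (es<D : All (ℕ._< D) es) (fs<D : All (ℕ._< D) fs)
             (monic : y ^ D + sumPowers y es ≈ sumPowers y fs) where

      open import Relation.Binary.Reasoning.Setoid setoid

      basis : List Carrier
      basis = map (λ j → d * y ^ j) (upTo D)

      -- In the presence of `w`, the element `d * a` can be exchanged for a combination of the
      -- `d * y ^ j` with `j < D`.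
      Reducible : Carrier → Set (c ⊔ ℓ)
      Reducible a = ∃ λ u → Additive.Combination basis u × w + d * a ≈ w + u

      reducible-resp : ∀ {a b} → w + d * a ≈ w + d * b → Reducible b → Reducible a
      reducible-resp a~b (u , comb , eq) = u , comb , trans a~b eq

      reducible-0 : Reducible 0#
      reducible-0 = 0# , Additive.combination-ε basis , +-congˡ (zeroʳ d)

      reducible-+ : ∀ {a b} → Reducible a → Reducible b → Reducible (a + b)
      reducible-+ {a} {b} (u , cu , a~u) (v , cv , b~v) = u + v , Additive.combination-∙ cu cv , (begin
        w + d * (a + b)      ≈⟨ +-congˡ (distribˡ d a b) ⟩
        w + (d * a + d * b)  ≈⟨ +-assoc w _ _ ⟨
        w + d * a + d * b    ≈⟨ +-congʳ a~u ⟩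
        w + u + d * b        ≈⟨ xy∙z≈xz∙y w u _ ⟩
        w + d * b + u        ≈⟨ +-congʳ b~v ⟩
        w + v + u            ≈⟨ xy∙z≈xz∙y w v u ⟩
        w + u + v            ≈⟨ +-assoc w u v ⟩
        w + (u + v)          ∎)

      reducible-· : ∀ k {a} → Reducible a → Reducible (k · a)
      reducible-· zero    red = reducible-0
      reducible-· (suc k) red = reducible-+ red (reducible-· k red)

      reducible-sumPowers : ∀ {es} → All (λ e → Reducible (y ^ e)) es → Reducible (sumPowers y es)
      reducible-sumPowers []           = reducible-0
      reducible-sumPowers (red ∷ reds) = reducible-+ red (reducible-sumPowers reds)

      ι*dsumPowers≲w : ∀ es → ι * (d * sumPowers y es) ≲ w
      ι*dsumPowers≲w []       = ≲-trans (≲-reflexive (trans (*-congˡ (zeroʳ d)) (zeroʳ ι))) (0≲ w)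
      ι*dsumPowers≲w (e ∷ es) = ≲-trans (≲-reflexive (*-congˡ (distribˡ d _ _)))
        (ι*-join (ι*dy^≲w e) (ι*dsumPowers≲w es))

      reducible-^ : ∀ k → Reducible (y ^ k)
      reducible-^ = <-rec _ λ k rec → go k rec
        where
        go : ∀ k → (∀ {j} → j ℕ.< k → Reducible (y ^ j)) → Reducible (y ^ k)
        go k rec with k ℕ.<? D
        ... | yes k<D = d * y ^ k ,
          Additive.combination-∈ (Any.map⁺ (Any.map (λ { ≡.refl → refl }) (∈-upTo⁺ k<D))) , refl
        ... | no  k≮D with t , ≡.refl ← ℕ.m≤n⇒∃[o]m+o≡n (ℕ.≮⇒≥ k≮D) =
          -- `F + q · F` is `ι * F`, and `w` absorbs `ι * (d * F)`. So `q · F` acts as the negative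
          -- of `F`, and the monic equation can be solved for `y ^ (D + t)`.
          reducible-resp eq (reducible-+ (lower fs<D) (reducible-· q (lower es<D)))
          where
          lowerAll : ∀ {es} → All (ℕ._< D) es → All (λ e → Reducible (y ^ e)) (map (t ℕ.+_) es)
          lowerAll es<D = All.map⁺ (All.map
            (λ {e} e<D → rec (ℕ.<-≤-trans (ℕ.+-monoʳ-< t e<D) (ℕ.≤-reflexive (ℕ.+-comm t D)))) es<D)

          lower : ∀ {es} → All (ℕ._< D) es → Reducible (sumPowers y (map (t ℕ.+_) es))
          lower es<D = reducible-sumPowers (lowerAll es<D)

          F = sumPowers y (map (t ℕ.+_) es)
          G = sumPowers y (map (t ℕ.+_) fs)

          monicShifted : y ^ (D ℕ.+ t) + F ≈ G
          monicShifted = begin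
            y ^ (D ℕ.+ t) + F
              ≈⟨ +-cong (trans (^-congʳ y (ℕ.+-comm D t)) (^-homo-* y t D)) (sumPowers-shift y t es) ⟩
            y ^ t * y ^ D + y ^ t * sumPowers y es  ≈⟨ distribˡ _ _ _ ⟨
            y ^ t * (y ^ D + sumPowers y es)        ≈⟨ *-congˡ monic ⟩
            y ^ t * sumPowers y fs                  ≈⟨ sumPowers-shift y t fs ⟨
            G                                       ∎

          eq : w + d * y ^ (D ℕ.+ t) ≈ w + d * (G + q · F)
          eq = begin
            w + d * y ^ (D ℕ.+ t)
              ≈⟨ +-congʳ (absorb (ι*-idem _) (ι*dsumPowers≲w (map (t ℕ.+_) es))) ⟨
            w + ι * (d * F) + d * y ^ (D ℕ.+ t)
              ≈⟨ solve 5 (λ w ι d f y → w :+ ι :* (d :* f) :+ d :* y := w :+ d :* (y :+ ι :* f))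
                   refl w ι d F (y ^ (D ℕ.+ t)) ⟩
            w + d * (y ^ (D ℕ.+ t) + ι * F)
              ≈⟨ +-congˡ (*-congˡ (+-congˡ (multiple≈ι* F))) ⟨
            w + d * (y ^ (D ℕ.+ t) + (F + q · F))
              ≈⟨ +-congˡ (*-congˡ (+-assoc _ F _)) ⟨
            w + d * (y ^ (D ℕ.+ t) + F + q · F)
              ≈⟨ +-congˡ (*-congˡ (+-congʳ monicShifted)) ⟩
            w + d * (G + q · F)  ∎

      -- Repeated use of `w * y ≈ d + w` gives for `a` the geometric sum of the powers of `y` below
      -- `i`.
      w*y^-reducible : ∀ i → ∃ λ a → Reducible a × w * y ^ i ≈ w + d * a
      w*y^-reducible zero    = 0# , reducible-0 ,
        trans (*-identityʳ w) (trans (sym (+-identityʳ w)) (+-congˡ (sym (zeroʳ d))))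
      w*y^-reducible (suc i) with a , red , eq ← w*y^-reducible i =
        a + y ^ i , reducible-+ red (reducible-^ i) , (begin
          w * (y * y ^ i)         ≈⟨ *-assoc w y _ ⟨
          w * y * y ^ i           ≈⟨ *-congʳ d+w≈wy ⟨
          (d + w) * y ^ i         ≈⟨ solve 3 (λ d w z → (d :+ w) :* z := w :* z :+ d :* z) refl d w (y ^ i) ⟩
          w * y ^ i + d * y ^ i   ≈⟨ +-congʳ eq ⟩
          w + d * a + d * y ^ i   ≈⟨ solve 4 (λ w d a z → w :+ d :* a :+ d :* z := w :+ d :* (a :+ z)) refl w d a (y ^ i) ⟩
          w + d * (a + y ^ i)     ∎)

      finiteOrders : All Additive.FiniteOrder basis
      finiteOrders = All.universal (finiteAdditiveOrder finite) basis

      values : List Carrier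
      values = map (λ u → w + proj₁ u) (Additive.combinations finiteOrders)

      ∈-values : ∀ i → w * y ^ i ∈ values
      ∈-values i with a , (u , comb , a~u) , eq ← w*y^-reducible i =
        Any.map⁺ (Any.map (λ u≈v → trans eq (trans a~u (+-congˡ u≈v)))
          (Additive.combinations-complete finiteOrders comb))

  module _ (closed : ClosedUnderInverseHomomorphisms semiring) where

    closed⇒finiteAdditiveOrder : FiniteAdditiveOrder
    closed⇒finiteAdditiveOrder = hankelRank⇒finiteAdditiveOrder (proj₂ (closed⇒hankelRank closed (2 · 1#)))

    closed⇒finiteOrder : ∀ x → Multiplicative.FiniteOrder x
    closed⇒finiteOrder x = periodic⇒finiteOrder
      (hankelRank⇒orderPeriodic saturating (proj₂ (closed⇒hankelRank closed x)))
      where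
      saturating : Saturating
      saturating = finiteAdditiveOrder⇒saturating closed⇒finiteAdditiveOrder

      periodic⇒finiteOrder :
        (∃₂ λ b p → 0 ℕ.< p × x ^ b * x ^ p ≲ x ^ b × x ^ b ≲ x ^ b * x ^ p) →
        Multiplicative.FiniteOrder x
      periodic⇒finiteOrder (b , p , 0<p , (d′ , d′+wy≈w) , (d , d+w≈wy)) =
        monic⇒finiteOrder (hankelRank⇒monic (proj₁ rankOfPower))
        where
        -- `p` need not be a power of 4, so closure is applied once more, to `x ^ p` in place of
        -- `x`.
        rankOfPower = closed⇒hankelRank closed (x ^ p)

        monic⇒finiteOrder :
          (∃ λ D → ∃₂ λ es fs → All (ℕ._< D) es × All (ℕ._< D) fs ×
            ∀ y → HankelRank (proj₁ rankOfPower) y → y ^ D + sumPowers y es ≈ sumPowers y fs) →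
          Multiplicative.FiniteOrder x
        monic⇒finiteOrder (D , es , fs , es<D , fs<D , monic) = repetition⇒finiteOrder b p 0<p _
          (∈-values saturating closed⇒finiteAdditiveOrder d+w≈wy d′+wy≈w es<D fs<D
            (monic (x ^ p) (proj₂ rankOfPower)))

    closed⇒locallyFinite : LocallyFinite semiring
    closed⇒locallyFinite X = map toGenerated sums , λ (x , x∈) →
      Any.map⁺ (Additive.combinations-complete finiteSums (generated⇒sum x∈))
      where
      finiteX : All Multiplicative.FiniteOrder X
      finiteX = All.universal closed⇒finiteOrder X

      monomials : List Carrier
      monomials = map proj₁ (Multiplicative.combinations finiteX)

      finiteSums : All Additive.FiniteOrder monomials
      finiteSums = All.universal (finiteAdditiveOrder closed⇒finiteAdditiveOrder) monomials

      sums = Additive.combinations finiteSums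

      Sum : Carrier → Set (c ⊔ ℓ)
      Sum = Additive.Combination monomials

      ∈-monomials : ∀ {u} → Multiplicative.Combination X u → u ∈ monomials
      ∈-monomials comb = Any.map⁺ (Multiplicative.combinations-complete finiteX comb)

      generated-monomial : ∀ {u} → Multiplicative.Combination X u → Generated semiring X u
      generated-monomial = Multiplicative.combination-elim (Generated semiring X) resp one mul gen

      toGenerated : ∃ Sum → ∃ (Generated semiring X)
      toGenerated (u , comb) = u , Additive.combination-elim (Generated semiring X) resp zero add
        (λ u∈ → let v , u≈v = Any.satisfied (Any.map⁻ u∈) in
          resp (sym u≈v) (generated-monomial (proj₂ v))) comb

      monomial : ∀ {u} → u ∈ monomials → Multiplicative.Combination X u
      monomial u∈ = let v , u≈v = Any.satisfied (Any.map⁻ u∈) in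
        Multiplicative.combination-resp (sym u≈v) (proj₂ v)

      -- Distributivity in both arguments reduces the claim to monomials, whose products are
      -- monomials by commutativity.
      sum-* : ∀ {u v} → Sum u → Sum v → Sum (u * v)
      sum-* {v = v} su sv = Additive.combination-elim (λ u → Sum (u * v))
        (λ u≈u′ → Additive.combination-resp (*-congʳ u≈u′))
        (Additive.combination-resp (sym (zeroˡ v)) (Additive.combination-ε monomials))
        (λ su su′ → Additive.combination-resp (sym (distribʳ v _ _)) (Additive.combination-∙ su su′))
        (λ {u} u∈ → Additive.combination-elim (λ v → Sum (u * v))
          (λ v≈v′ → Additive.combination-resp (*-congˡ v≈v′))
          (Additive.combination-resp (sym (zeroʳ u)) (Additive.combination-ε monomials))
          (λ sv sv′ → Additive.combination-resp (sym (distribˡ u _ _)) (Additive.combination-∙ sv sv′))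
          (λ v∈ → Additive.combination-∈ (∈-monomials (Multiplicative.combination-∙ (monomial u∈) (monomial v∈))))
          sv)
        su

      generated⇒sum : ∀ {u} → Generated semiring X u → Sum u
      generated⇒sum (gen u∈X)    = Additive.combination-∈ (∈-monomials (Multiplicative.combination-∈ u∈X))
      generated⇒sum zero         = Additive.combination-ε monomials
      generated⇒sum one          = Additive.combination-∈ (∈-monomials (Multiplicative.combination-ε X))
      generated⇒sum (add u∈ v∈)  = Additive.combination-∙ (generated⇒sum u∈) (generated⇒sum v∈)
      generated⇒sum (mul u∈ v∈)  = sum-* (generated⇒sum u∈) (generated⇒sum v∈)
      generated⇒sum (resp u≈v u∈) = Additive.combination-resp u≈v (generated⇒sum u∈)

theorem7p1 : {c ℓ : Level} (S : CommutativeSemiring c ℓ) →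
    ClosedUnderInverseHomomorphisms (CommutativeSemiring.semiring S)
    ⇔ LocallyFinite (CommutativeSemiring.semiring S)
theorem7p1 S = mk⇔ (FinitePowers.closed⇒locallyFinite S)
  (LocallyFiniteClosed.locallyFinite⇒closed (CommutativeSemiring.semiring S))
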